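{- The integrality gap of the configuration-LP, restricted to instances of the unrelated graph balancing problem, equals $2$. That is, $\sup_I C^*(I)/C_{\mathrm{conf}}(I) = 2$, where the supremum ranges over all instances $I$ of the unrelated graph balancing problem, $C^*(I)$ is the minimum makespan of $I$, and $C_{\mathrm{conf}}(I)$ is the smallest integer $T$ for which the configuration-LP of $I$ with target makespan $T$ is feasible.
   Context: Scheduling on unrelated machines ($R||C_{\max}$): an instance $I$ consists of a finite nonempty set $J$ of jobs, a finite nonempty set $M$ of machines, and processing times $p_{i,j}\in\mathbb{N}^+\cup\{\infty\}$ for $i\in M$, $j\in J$, such that each job has finite processing time on at least one machine. A (integral) schedule assigns each job $j$ to one machine; the load of machine $i$ is the sum of $p_{i,j}$ over jobs $j$ assigned to $i$; the makespan is the maximum load. $C^*(I)$ denotes the minimum makespan over all assignments. Unrelated graph balancing problem: the special case in which each job has finite (possibly different) processing times on at most two machines. Configuration-LP with target makespan $T$: for $i\in M$ let $\mathcal{C}_i(T)=\{C\subseteq J : \sum_{j\in C}p_{i,j}\le T\}$. The LP has variables $y_{i,C}\ge 0$ for $i\in M$, $C\in\mathcal{C}_i(T)$ and constraints $$\sum_{C\in\mathcal{C}_i(T)} y_{i,C}=1\ \text{ for all } i\in M,\qquad \sum_{i\in M}\ \sum_{C\in\mathcal{C}_i(T):\,C\ni j} y_{i,C}=1\ \text{ for all } j\in J.$$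
   Formalization: The variables y of the configuration-LP are rational instead of real numbers; since the LP has rational data, feasibility for a target T, and hence the value C_conf(I), is the same. -}

module Defs where

open import Algebra.Bundles.Raw using (RawMonoid)
import Algebra.Definitions.RawMonoid as RawMonoidDefinitions
open import Data.Bool.Base using (if_then_else_)
open import Data.Empty using (⊥-elim)
open import Data.Fin.Base using (Fin; zero; suc)
import Data.Fin.Properties as Fin
open import Data.Fin.Subset using (Subset; inside; outside; _∈_; ∣_∣)
open import Data.Fin.Subset.Properties using (_∈?_)
open import Data.Integer.Base using (+_)
open import Data.List.Base as List using (List; []; _∷_; _++_; filter)
open import Data.List.Properties using (filter-none)
open import Data.List.Relation.Unary.All as All using ()
open import Data.List.Relation.Unary.All.Properties using (all-filter)
open import Data.Nat.Base as ℕ using (ℕ; zero; suc; NonZero)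
import Data.Nat.Properties as ℕ
open import Data.Product using (∃-syntax; _×_; _,_)
open import Data.Rational.Base as ℚ using (ℚ; 0ℚ; 1ℚ; _/_)
import Data.Rational.Properties as ℚ
open import Data.Vec.Base as Vec using (tabulate; []; _∷_)
import Data.Vec.Functional as Vector
open import Level using (0ℓ)
open import Relation.Binary.Construct.Add.Supremum.NonStrict ℕ._≤_ public
  using (_≤⁺_; [_]; _≤⊤⁺; ≤⁺-dec)
open import Relation.Binary.PropositionalEquality
  using (_≡_; _≢_; refl; sym; trans; cong; cong₂)
open import Relation.Nullary using (¬_; Dec; yes; no; does)
open import Relation.Nullary.Construct.Add.Supremum public using (_⁺; [_]; ⊤⁺)
open import Relation.Unary using (Pred)

------------------------------------------------------------------------
-- ℕ ∪ {∞}

ℕ∞ : Set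
ℕ∞ = ℕ ⁺

pattern ∞ = ⊤⁺

data Finite : ℕ∞ → Set where
  finite : ∀ {k} → Finite [ k ]

finite? : ∀ x → Dec (Finite x)
finite? [ _ ] = yes finite
finite? ∞     = no λ ()

infixl 6 _+∞_ _⊔∞_

_+∞_ : ℕ∞ → ℕ∞ → ℕ∞
[ k ] +∞ [ l ] = [ k ℕ.+ l ]
[ _ ] +∞ ∞     = ∞
∞     +∞ _     = ∞

_⊔∞_ : ℕ∞ → ℕ∞ → ℕ∞
[ k ] ⊔∞ [ l ] = [ k ℕ.⊔ l ]
[ _ ] ⊔∞ ∞     = ∞
∞     ⊔∞ _     = ∞

+∞-0-rawMonoid : RawMonoid 0ℓ 0ℓ
+∞-0-rawMonoid = record { _≈_ = _≡_ ; _∙_ = _+∞_ ; ε = [ 0 ] }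

open RawMonoidDefinitions +∞-0-rawMonoid public
  using () renaming (sum to sum∞)

open RawMonoidDefinitions ℚ.+-0-rawMonoid public
  using () renaming (sum to sumℚ)

max∞ : ∀ {n} → (Fin n → ℕ∞) → ℕ∞
max∞ = Vector.foldr _⊔∞_ [ 0 ]

------------------------------------------------------------------------
-- Instances and schedules

record Instance : Set where
  field
    #machines #jobs  : ℕ
    machinesNonempty : NonZero #machines
    jobsNonempty     : NonZero #jobs
    p                : Fin #machines → Fin #jobs → ℕ∞
    positive         : ∀ i j → p i j ≢ [ 0 ]
    schedulable      : ∀ j → ∃[ i ] Finite (p i j)

  Machine Job : Set
  Machine = Fin #machines
  Job     = Fin #jobs

  -- The total processing time on machine i of a set of jobs.
  cost : Machine → Subset #jobs → ℕ∞
  cost i C = sum∞ λ j → if does (j ∈? C) then p i j else [ 0 ]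

  Schedule : Set
  Schedule = Job → Machine

  jobsOn : Schedule → Machine → Subset #jobs
  jobsOn σ i = tabulate λ j → does (σ j Fin.≟ i)

  makespan : Schedule → ℕ∞
  makespan σ = max∞ λ i → cost i (jobsOn σ i)

  -- The minimum is finite because every job is schedulable.
  IsMinMakespan : ℕ → Set
  IsMinMakespan c =
    (∃[ σ ] makespan σ ≡ [ c ]) × (∀ σ → [ c ] ≤⁺ makespan σ)

  finiteMachines : Job → Subset #machines
  finiteMachines j = tabulate λ i → does (finite? (p i j))

open Instance public

UnrelatedGraphBalancing : Pred Instance 0ℓ
UnrelatedGraphBalancing I = ∀ j → ∣ finiteMachines I j ∣ ℕ.≤ 2

------------------------------------------------------------------------
-- The configuration-LP

subsets : ∀ n → List (Subset n)
subsets zero    = [] ∷ []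
subsets (suc n) =
  List.map (outside ∷_) (subsets n) ++ List.map (inside ∷_) (subsets n)

IsConfiguration : (I : Instance) → ℕ → Machine I → Subset (#jobs I) → Set
IsConfiguration I T i C = cost I i C ≤⁺ [ T ]

isConfiguration? : ∀ I T i C → Dec (IsConfiguration I T i C)
isConfiguration? I T i C = ≤⁺-dec ℕ._≤?_ (cost I i C) [ T ]

configurations : (I : Instance) → ℕ → Machine I → List (Subset (#jobs I))
configurations I T i = filter (isConfiguration? I T i) (subsets (#jobs I))

sumOver : ∀ {A : Set} → List A → (A → ℚ) → ℚ
sumOver xs f = List.foldr ℚ._+_ 0ℚ (List.map f xs)

-- Only the values y i C with C a configuration for machine i are
-- variables of the LP; the other values of y are neither constrained nor
-- used.  Since the LP has rational coefficients, it has a real solution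
-- exactly when it has a rational one.
record ConfigLP (I : Instance) (T : ℕ) : Set where
  field
    y          : Machine I → Subset (#jobs I) → ℚ
    nonneg     : ∀ i C → IsConfiguration I T i C → 0ℚ ℚ.≤ y i C
    perMachine : ∀ i → sumOver (configurations I T i) (y i) ≡ 1ℚ
    perJob     : ∀ j →
      sumℚ (λ i → sumOver (filter (j ∈?_) (configurations I T i)) (y i)) ≡ 1ℚ

-- A negative target makespan leaves no configurations at all, so the
-- smallest integer target is the smallest natural one.
IsConfigLPValue : Instance → ℕ → Set
IsConfigLPValue I t = ConfigLP I t × (∀ T → ConfigLP I T → t ℕ.≤ T)

------------------------------------------------------------------------
-- With target 0 the configuration-LP is infeasible, so the ratio of the
-- two optima is always defined.

private
  +∞-≡0ˡ : ∀ x y → x +∞ y ≤⁺ [ 0 ] → x ≡ [ 0 ]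
  +∞-≡0ˡ [ zero  ] y     h     = refl
  +∞-≡0ˡ [ suc k ] [ l ] [ () ]
  +∞-≡0ˡ [ suc k ] ∞     ()
  +∞-≡0ˡ ∞         y     ()

  +∞-≤0ʳ : ∀ x y → x +∞ y ≤⁺ [ 0 ] → y ≤⁺ [ 0 ]
  +∞-≤0ʳ [ k ] [ l ] [ h ] = [ ℕ.≤-trans (ℕ.m≤n+m l k) h ]
  +∞-≤0ʳ [ k ] ∞     ()
  +∞-≤0ʳ ∞     y     ()

  sum∞-≡0 : ∀ {n} (f : Fin n → ℕ∞) → sum∞ f ≤⁺ [ 0 ] → ∀ j → f j ≡ [ 0 ]
  sum∞-≡0 f h zero    = +∞-≡0ˡ (f zero) _ h
  sum∞-≡0 f h (suc j) = sum∞-≡0 (λ k → f (suc k)) (+∞-≤0ʳ (f zero) _ h) j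

  sumℚ-≡0 : ∀ {n} (f : Fin n → ℚ) → (∀ i → f i ≡ 0ℚ) → sumℚ f ≡ 0ℚ
  sumℚ-≡0 {zero}  f h = refl
  sumℚ-≡0 {suc n} f h =
    cong₂ ℚ._+_ (h zero) (sumℚ-≡0 (λ i → f (suc i)) (λ i → h (suc i)))

  configuration-0 : ∀ I i C → IsConfiguration I 0 i C → ∀ j → ¬ (j ∈ C)
  configuration-0 I i C h j j∈C with j ∈? C | sum∞-≡0 _ h j
  ... | yes _  | eq = positive I i j eq
  ... | no j∉C | _  = j∉C j∈C

  firstJob : ∀ I → Job I
  firstJob record { #jobs = suc _ } = zero

configLP-0-infeasible : ∀ I → ¬ ConfigLP I 0
configLP-0-infeasible I lp = 0≢1 (trans (sym (sumℚ-≡0 _ vanish)) (perJob j))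
  where
  open ConfigLP lp

  j : Job I
  j = firstJob I

  0≢1 : 0ℚ ≢ 1ℚ
  0≢1 ()

  vanish : ∀ i →
    sumOver (filter (j ∈?_) (configurations I 0 i)) (y i) ≡ 0ℚ
  vanish i = cong (λ Cs → sumOver Cs (y i)) (filter-none (j ∈?_)
    (All.map (λ {C} h → configuration-0 I i C h j)
      (all-filter (isConfiguration? I 0 i) (subsets (#jobs I)))))

configLPValue-nonZero : ∀ {I t} → IsConfigLPValue I t → NonZero t
configLPValue-nonZero {I} {zero}  (lp , _) = ⊥-elim (configLP-0-infeasible I lp)
configLPValue-nonZero {I} {suc t} _        = _

------------------------------------------------------------------------
-- Integrality gap

-- The ratios of the minimum makespan to the configuration-LP value, over
-- all instances in the class K.
data GapRatio (K : Pred Instance 0ℓ) : Pred ℚ 0ℓ where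
  ratio : ∀ I {c t} → K I → IsMinMakespan I c → (v : IsConfigLPValue I t) →
          GapRatio K ((+ c / t) {{configLPValue-nonZero v}})

-- The constructive notion of supremum: an upper bound approximated from
-- below by elements of the set.  Over a linear order this is classically
-- the same as being the least upper bound (among rational or, by density,
-- among real upper bounds).
IsSupremum : Pred ℚ 0ℓ → ℚ → Set
IsSupremum P s = (∀ r → P r → r ℚ.≤ s) × (∀ q → q ℚ.< s → ∃[ r ] (P r × q ℚ.< r))

IsSupremum⇒least : ∀ {P s} → IsSupremum P s →
                   ∀ b → (∀ r → P r → r ℚ.≤ b) → s ℚ.≤ b
IsSupremum⇒least (_ , approx) b bound = ℚ.≮⇒≥ λ b<s →
  let r , Pr , b<r = approx b b<s in ℚ.<-irrefl refl (ℚ.<-≤-trans b<r (bound r Pr))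

IsIntegralityGap : Pred Instance 0ℓ → ℚ → Set
IsIntegralityGap K s = IsSupremum (GapRatio K) s

{-# OPTIONS --safe #-}

-- Upper bound: a solution of the configuration-LP with target T splits every
-- job between at most two machines, one of which gets at least half of it.
-- Moving the job there entirely at most doubles the load of each machine.
--
-- Lower bound: write k = K + 1 and take a k-ary tree of machines.  Each edge is
-- a job with time 1 on the parent and K on the child; the root has a job of its
-- own with time k, and each leaf has k further jobs with time 1 which could also
-- be processed, in time K, by one extra machine per leaf.  In a schedule with
-- makespan below 2K the extra machine takes at most one of the k jobs, so a leaf
-- has load at least K already and cannot process its edge to the parent.  By
-- induction towards the root, every inner node must then process all k edges to
-- its children and cannot process its own edge either; the root job is stuck.
-- In the LP with target k, a node that holds its own edge with weight x combines
-- it with each of its child edges with weight x/k, and processes all child edges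
-- together with weight 1 − x.  Hence the weight x shrinks by the factor 1 − 1/k
-- per level, and from 1/k on, the extra machines can absorb it.  The gap of this
-- instance is therefore 2K/(K + 1).

module Submission where

open import Defs
open import Algebra.Bundles using (CommutativeMonoid; CommutativeRing)
import Algebra.Properties.CommutativeMonoid.Sum as CommutativeMonoidSum
import Algebra.Properties.Semiring.Mult as SemiringMult
import Algebra.Properties.Semiring.Sum as SemiringSum
open import Data.Bool.Base using (Bool; true; false; if_then_else_)
import Data.Bool.Properties as Bool
open import Data.Empty using (⊥)
open import Data.Fin.Base using
  (Fin; zero; suc; toℕ; fromℕ<; inject≤; punchIn; punchOut;
   combine; quotient; remainder; splitAt; join; _↑ˡ_; _↑ʳ_)
import Data.Fin.Properties as Fin
open import Data.Fin.Subset using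
  (Subset; inside; outside; _∈_; _∉_; ∣_∣; ⁅_⁆; _∪_)
open import Data.Fin.Subset.Properties using
  (_∈?_; drop-there; p⊆q⇒∣p∣≤∣q∣; ∣⁅x⁆∣≡1; x∈⁅x⁆; x∈p∪q⁺)
import Data.Integer.Properties as ℤ
open import Data.List.Base as List using (List; []; _∷_; _++_; filter)
open import Data.List.Properties using (filter-none)
open import Data.List.Relation.Unary.All as All using (All; []; _∷_)
open import Data.List.Relation.Unary.All.Properties using (all-filter)
open import Data.Nat.Base as ℕ using (ℕ; zero; suc; z≤n; s≤s)
import Data.Nat.Divisibility as ℕ using (m∣m*n)
import Data.Nat.DivMod as ℕ
import Data.Nat.Properties as ℕ
open import Data.Product using (∃-syntax; _×_; _,_; proj₁; proj₂)
open import Data.Rational.Base as ℚ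
  using (ℚ; 0ℚ; 1ℚ; ½; _+_; _*_; _-_; _≤_; _<_)
import Data.Rational.Properties as ℚ
open import Data.Rational.Solver using (module +-*-Solver)
open import Data.Rational.Unnormalised.Base as ℚᵘ using (mkℚᵘ)
import Data.Rational.Unnormalised.Properties as ℚᵘ
open import Data.Sum.Base using (_⊎_; inj₁; inj₂; [_,_]′)
open import Data.Vec.Base using (tabulate; []; _∷_)
open import Data.Vec.Properties using
  (lookup∘tabulate; []=⇒lookup; lookup⇒[]=; ≡-dec)
open import Function.Base using (_∘_)
open import Level using (0ℓ)
open import Relation.Binary.Construct.Add.Supremum.NonStrict ℕ._≤_
  using ([≤]-injective; ≤⁺-antisym-≡)
open import Relation.Binary.PropositionalEquality
open import Relation.Nullary using (¬_; Dec; yes; no; does; contradiction)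
open import Relation.Nullary.Construct.Add.Supremum using ([]-injective)
open import Relation.Nullary.Decidable using (dec-true; dec-false; toWitnessFalse)
open import Relation.Unary using (Pred; Decidable)

-- Conditionals, finite sums in commutative monoids, and tabulated subsets.

if-yes : ∀ {A P : Set} {x y : A} (P? : Dec P) → P → (if does P? then x else y) ≡ x
if-yes {x = x} {y} P? p = cong (if_then x else y) (dec-true P? p)

if-no : ∀ {A P : Set} {x y : A} (P? : Dec P) → ¬ P → (if does P? then x else y) ≡ y
if-no {x = x} {y} P? ¬p = cong (if_then x else y) (dec-false P? ¬p)

module Sum (M : CommutativeMonoid 0ℓ 0ℓ) where
  open CommutativeMonoid M using (Carrier; _≈_; ε; _∙_; identityʳ; ∙-congˡ)
    renaming (refl to ≈-refl; trans to ≈-trans; sym to ≈-sym; reflexive to ≈-reflexive)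
  open CommutativeMonoidSum M public

  sum-zero : ∀ {n} (f : Fin n → Carrier) → (∀ i → f i ≈ ε) → sum f ≈ ε
  sum-zero {n} f f≈ε = ≈-trans (sum-cong-≋ f≈ε) (sum-replicate-zero n)

  sum-single : ∀ {n} (f : Fin n → Carrier) i → (∀ j → j ≢ i → f j ≈ ε) → sum f ≈ f i
  sum-single {suc n} f i f≈ε = ≈-trans (sum-remove f)
    (≈-trans (∙-congˡ (sum-zero (f ∘ punchIn i) λ j → f≈ε _ (Fin.punchInᵢ≢i i j)))
      (identityʳ (f i)))

  sum-pair : ∀ {n} (f : Fin n → Carrier) {i j} → i ≢ j →
             (∀ l → l ≢ i → l ≢ j → f l ≈ ε) → sum f ≈ f i ∙ f j
  sum-pair {suc n} f {i} {j} i≢j f≈ε = ≈-trans (sum-remove f) (∙-congˡ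
    (≈-trans (sum-single (f ∘ punchIn i) (punchOut i≢j) λ l l≢ →
        f≈ε _ (Fin.punchInᵢ≢i i l) λ eq →
          l≢ (Fin.punchIn-injective i l _ (trans eq (sym (Fin.punchIn-punchOut i≢j)))))
      (≈-reflexive (cong f (Fin.punchIn-punchOut i≢j)))))

  -- Double counting: each `a` lies in the fibre of exactly one `j`, namely `e a`. This reduces
  -- comparing a sum along `e` with a sum over all of `Fin n` to comparing fibre by fibre.
  sum-fibres : ∀ {l n} (e : Fin l → Fin n) (f : Fin n → Carrier) →
               sum (f ∘ e) ≈ sum λ j → sum λ a → if does (e a Fin.≟ j) then f j else ε
  sum-fibres e f = ≈-trans (sum-cong-≋ λ a → ≈-sym (≈-trans
      (sum-single (λ j → if does (e a Fin.≟ j) then f j else ε) (e a) λ j j≢ →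
        ≈-reflexive (if-no (e a Fin.≟ j) (j≢ ∘ sym)))
      (≈-reflexive (if-yes (e a Fin.≟ e a) refl))))
    (∑-comm λ a j → if does (e a Fin.≟ j) then f j else ε)

module Sumℚ = Sum ℚ.+-0-commutativeMonoid

∈-tabulate⁺ : ∀ {n} {P : Pred (Fin n) 0ℓ} (P? : Decidable P) {j} →
              P j → j ∈ tabulate (does ∘ P?)
∈-tabulate⁺ P? {j} pj =
  lookup⇒[]= j _ (trans (lookup∘tabulate _ j) (dec-true (P? j) pj))

∈-tabulate⁻ : ∀ {n} {P : Pred (Fin n) 0ℓ} (P? : Decidable P) {j} →
              j ∈ tabulate (does ∘ P?) → P j
∈-tabulate⁻ P? {j} j∈ with P? j | trans (sym (lookup∘tabulate (does ∘ P?) j)) ([]=⇒lookup j∈)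
... | yes pj | _ = pj
... | no _   | ()

-- Natural numbers inside the rationals.

private
  ℚ-semiring = CommutativeRing.semiring ℚ.+-*-commutativeRing

open SemiringMult ℚ-semiring using (×-homo-+; ×1-homo-*) renaming (_×_ to _×ℚ_)
open SemiringSum ℚ-semiring using (*-distribˡ-sum)

-- As a multiple of `1ℚ`, `⟦ suc n ⟧` unfolds to `1ℚ + ⟦ n ⟧`, so inductions on naturals carry over
-- directly.
⟦_⟧ : ℕ → ℚ
⟦ n ⟧ = n ×ℚ 1ℚ

⟦⟧-mono-≤ : ∀ {m n} → m ℕ.≤ n → ⟦ m ⟧ ≤ ⟦ n ⟧
⟦⟧-mono-≤ {n = zero}  z≤n       = ℚ.≤-refl
⟦⟧-mono-≤ {n = suc n} z≤n       =
  ℚ.+-mono-≤ {0ℚ} {1ℚ} (ℚ.nonNegative⁻¹ 1ℚ) (⟦⟧-mono-≤ {n = n} z≤n)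
⟦⟧-mono-≤ (s≤s m≤n) = ℚ.+-monoʳ-≤ 1ℚ (⟦⟧-mono-≤ m≤n)

⟦⟧-mono-< : ∀ {m n} → m ℕ.< n → ⟦ m ⟧ < ⟦ n ⟧
⟦⟧-mono-< {m} m<n = ℚ.<-≤-trans
  (subst (_< ⟦ suc m ⟧) (ℚ.+-identityˡ ⟦ m ⟧) (ℚ.+-monoˡ-< ⟦ m ⟧ (ℚ.positive⁻¹ 1ℚ)))
  (⟦⟧-mono-≤ m<n)

⟦⟧-cancel-≤ : ∀ {m n} → ⟦ m ⟧ ≤ ⟦ n ⟧ → m ℕ.≤ n
⟦⟧-cancel-≤ ⟦m⟧≤⟦n⟧ = ℕ.≮⇒≥ λ n<m → ℚ.<-irrefl refl (ℚ.<-≤-trans (⟦⟧-mono-< n<m) ⟦m⟧≤⟦n⟧)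

0≤⟦_⟧ : ∀ n → 0ℚ ≤ ⟦ n ⟧
0≤⟦ n ⟧ = ⟦⟧-mono-≤ {0} {n} z≤n

-- Order, sums and maxima in ℕ ∪ {∞}.

+∞-assoc : ∀ x y z → (x +∞ y) +∞ z ≡ x +∞ (y +∞ z)
+∞-assoc [ k ] [ l ] [ m ] = cong [_] (ℕ.+-assoc k l m)
+∞-assoc [ _ ] [ _ ] ∞     = refl
+∞-assoc [ _ ] ∞     _     = refl
+∞-assoc ∞     _     _     = refl

+∞-comm : ∀ x y → x +∞ y ≡ y +∞ x
+∞-comm [ k ] [ l ] = cong [_] (ℕ.+-comm k l)
+∞-comm [ _ ] ∞     = refl
+∞-comm ∞     [ _ ] = refl
+∞-comm ∞     ∞     = refl

+∞-identityˡ : ∀ x → [ 0 ] +∞ x ≡ x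
+∞-identityˡ [ _ ] = refl
+∞-identityˡ ∞     = refl

+∞-identityʳ : ∀ x → x +∞ [ 0 ] ≡ x
+∞-identityʳ x = trans (+∞-comm x [ 0 ]) (+∞-identityˡ x)

+∞-0-commutativeMonoid : CommutativeMonoid 0ℓ 0ℓ
+∞-0-commutativeMonoid = record
  { Carrier = ℕ∞ ; _≈_ = _≡_ ; _∙_ = _+∞_ ; ε = [ 0 ]
  ; isCommutativeMonoid = record
    { isMonoid = record
      { isSemigroup = record
        { isMagma = record { isEquivalence = isEquivalence ; ∙-cong = cong₂ _+∞_ }
        ; assoc = +∞-assoc }
      ; identity = +∞-identityˡ , +∞-identityʳ }
    ; comm = +∞-comm } }

module Sum∞ = Sum +∞-0-commutativeMonoid

≤∞-refl : ∀ {x} → x ≤⁺ x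
≤∞-refl {[ _ ]} = [ ℕ.≤-refl ]
≤∞-refl {∞}     = ∞ ≤⊤⁺

≤∞-reflexive : ∀ {x y} → x ≡ y → x ≤⁺ y
≤∞-reflexive refl = ≤∞-refl

≤∞-trans : ∀ {x y z} → x ≤⁺ y → y ≤⁺ z → x ≤⁺ z
≤∞-trans [ p ] [ q ]    = [ ℕ.≤-trans p q ]
≤∞-trans p     (_ ≤⊤⁺) = _ ≤⊤⁺

0≤∞ : ∀ {x} → [ 0 ] ≤⁺ x
0≤∞ {[ _ ]} = [ z≤n ]
0≤∞ {∞}     = _ ≤⊤⁺

+∞-mono-≤ : ∀ {x x′ y y′} → x ≤⁺ x′ → y ≤⁺ y′ → x +∞ y ≤⁺ x′ +∞ y′
+∞-mono-≤ [ p ]          [ q ]    = [ ℕ.+-mono-≤ p q ]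
+∞-mono-≤ {x′ = [ _ ]} _ (_ ≤⊤⁺) = _ ≤⊤⁺
+∞-mono-≤ (_ ≤⊤⁺)        _        = _ ≤⊤⁺

x≤x+∞y : ∀ x y → x ≤⁺ x +∞ y
x≤x+∞y x y = subst (_≤⁺ x +∞ y) (+∞-identityʳ x) (+∞-mono-≤ (≤∞-refl {x}) 0≤∞)

sum∞-mono : ∀ {n} {f g : Fin n → ℕ∞} → (∀ i → f i ≤⁺ g i) → sum∞ f ≤⁺ sum∞ g
sum∞-mono {zero}  f≤g = ≤∞-refl
sum∞-mono {suc n} f≤g = +∞-mono-≤ (f≤g zero) (sum∞-mono (f≤g ∘ suc))

sum∞-lookup : ∀ {n} (f : Fin n → ℕ∞) i → f i ≤⁺ sum∞ f
sum∞-lookup {suc n} f i = subst (f i ≤⁺_) (sym (Sum∞.sum-remove f)) (x≤x+∞y (f i) _)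

-- The fibre over an index with nonzero term is inhabited, so its sum contains that term at least
-- once.
sum∞-cover : ∀ {l n} (e : Fin l → Fin n) (f : Fin n → ℕ∞) →
             (∀ j → f j ≡ [ 0 ] ⊎ ∃[ a ] e a ≡ j) → sum∞ f ≤⁺ sum∞ (f ∘ e)
sum∞-cover e f cover = subst (sum∞ f ≤⁺_) (sym (Sum∞.sum-fibres e f)) (sum∞-mono bound)
  where
  fibre : ∀ j a → ℕ∞
  fibre j a = if does (e a Fin.≟ j) then f j else [ 0 ]

  bound : ∀ j → f j ≤⁺ sum∞ (fibre j)
  bound j with cover j
  ... | inj₁ fj≡0       = subst (_≤⁺ sum∞ (fibre j)) (sym fj≡0) 0≤∞
  ... | inj₂ (a , ea≡j) = subst (_≤⁺ sum∞ (fibre j))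
    (if-yes (e a Fin.≟ j) ea≡j) (sum∞-lookup (fibre j) a)

-- By injectivity a fibre has at most one element, so no term of `f` is counted twice.
sum∞-injective : ∀ {l n} (e : Fin l → Fin n) (f : Fin n → ℕ∞) →
                 (∀ {a b} → e a ≡ e b → a ≡ b) → sum∞ (f ∘ e) ≤⁺ sum∞ f
sum∞-injective e f inj = subst (_≤⁺ sum∞ f) (sym (Sum∞.sum-fibres e f)) (sum∞-mono bound)
  where
  fibre : ∀ j a → ℕ∞
  fibre j a = if does (e a Fin.≟ j) then f j else [ 0 ]

  bound : ∀ j → sum∞ (fibre j) ≤⁺ f j
  bound j with Fin.any? (λ a → e a Fin.≟ j)
  ... | yes (a , refl) = ≤∞-reflexive (trans
    (Sum∞.sum-single (fibre (e a)) a λ b b≢a →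
      if-no (e b Fin.≟ e a) (b≢a ∘ inj))
    (if-yes (e a Fin.≟ e a) refl))
  ... | no ∄a = subst (_≤⁺ f j) (sym (Sum∞.sum-zero (fibre j) λ b →
      if-no (e b Fin.≟ j) λ eq → ∄a (b , eq))) 0≤∞

-- Junk value at ∞.
value : ℕ∞ → ℕ
value [ k ] = k
value ∞     = 0

-- A finite total forces every term to be finite, so the junk value never enters.
sum∞-value : ∀ {n} (f : Fin n → ℕ∞) {t} → sum∞ f ≡ [ t ] →
             sumℚ (λ j → ⟦ value (f j) ⟧) ≡ ⟦ t ⟧
sum∞-value {zero}  f refl = refl
sum∞-value {suc n} f eq with f zero | sum∞ (f ∘ suc) in tail-eq
sum∞-value {suc n} f refl | [ k ] | [ l ] =
  trans (cong (⟦ k ⟧ +_) (sum∞-value (f ∘ suc) tail-eq)) (sym (×-homo-+ 1ℚ k l))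

sum∞-finite : ∀ {n} (f : Fin n → ℕ∞) → (∀ j → Finite (f j)) → ∃[ t ] sum∞ f ≡ [ t ]
sum∞-finite {zero}  f fin = 0 , refl
sum∞-finite {suc n} f fin with f zero | fin zero | sum∞-finite (f ∘ suc) (fin ∘ suc)
... | [ k ] | finite | l , eq = k ℕ.+ l , cong ([ k ] +∞_) eq

max∞-lub : ∀ {n} (f : Fin n → ℕ∞) {b} → (∀ i → f i ≤⁺ [ b ]) → max∞ f ≤⁺ [ b ]
max∞-lub {zero}  f f≤b = 0≤∞
max∞-lub {suc n} f f≤b with f zero | f≤b zero | max∞ (f ∘ suc) | max∞-lub (f ∘ suc) (f≤b ∘ suc)
... | [ _ ] | [ p ] | [ _ ] | [ q ] = [ ℕ.⊔-lub p q ]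

⊔∞-left : ∀ x y → x ≤⁺ x ⊔∞ y
⊔∞-left [ k ] [ l ] = [ ℕ.m≤m⊔n k l ]
⊔∞-left [ _ ] ∞     = _ ≤⊤⁺
⊔∞-left ∞     _     = _ ≤⊤⁺

⊔∞-right : ∀ x y → y ≤⁺ x ⊔∞ y
⊔∞-right [ k ] [ l ] = [ ℕ.m≤n⊔m k l ]
⊔∞-right [ _ ] ∞     = _ ≤⊤⁺
⊔∞-right ∞     _     = _ ≤⊤⁺

max∞-lookup : ∀ {n} (f : Fin n → ℕ∞) i → f i ≤⁺ max∞ f
max∞-lookup f zero    = ⊔∞-left (f zero) _
max∞-lookup f (suc i) = ≤∞-trans (max∞-lookup (f ∘ suc) i) (⊔∞-right (f zero) _)

-- Rational sums over index sets and over lists.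

sumℚ-mono : ∀ {n} {f g : Fin n → ℚ} → (∀ i → f i ≤ g i) → sumℚ f ≤ sumℚ g
sumℚ-mono {zero}  f≤g = ℚ.≤-refl
sumℚ-mono {suc n} f≤g = ℚ.+-mono-≤ (f≤g zero) (sumℚ-mono (f≤g ∘ suc))

module _ {A : Set} where

  sumOver-0 : ∀ (xs : List A) → sumOver xs (λ _ → 0ℚ) ≡ 0ℚ
  sumOver-0 []       = refl
  sumOver-0 (_ ∷ xs) = trans (ℚ.+-identityˡ _) (sumOver-0 xs)

  sumOver-cong : ∀ (xs : List A) {f g : A → ℚ} → (∀ x → f x ≡ g x) → sumOver xs f ≡ sumOver xs g
  sumOver-cong []       f≡g = refl
  sumOver-cong (x ∷ xs) f≡g = cong₂ _+_ (f≡g x) (sumOver-cong xs f≡g)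

  sumOver-mono : ∀ {xs : List A} {f g : A → ℚ} → All (λ x → f x ≤ g x) xs → sumOver xs f ≤ sumOver xs g
  sumOver-mono []             = ℚ.≤-refl
  sumOver-mono (f≤g ∷ all) = ℚ.+-mono-≤ f≤g (sumOver-mono all)

  sumOver-filter : ∀ {P : Pred A 0ℓ} (P? : Decidable P) (xs : List A) (f : A → ℚ) →
                   sumOver (filter P? xs) f ≡ sumOver xs (λ x → if does (P? x) then f x else 0ℚ)
  sumOver-filter P? []       f = refl
  sumOver-filter P? (x ∷ xs) f with does (P? x)
  ... | true  = cong (_+_ (f x)) (sumOver-filter P? xs f)
  ... | false = trans (sumOver-filter P? xs f) (sym (ℚ.+-identityˡ _))

  sumOver-*ʳ : ∀ (xs : List A) (f : A → ℚ) c → sumOver xs (λ x → f x * c) ≡ sumOver xs f * c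
  sumOver-*ʳ []       f c = sym (ℚ.*-zeroˡ c)
  sumOver-*ʳ (x ∷ xs) f c =
    trans (cong (_+_ (f x * c)) (sumOver-*ʳ xs f c)) (sym (ℚ.*-distribʳ-+ c (f x) _))

  sumOver-sumℚ : ∀ {n} (xs : List A) (g : Fin n → A → ℚ) →
                 sumOver xs (λ x → sumℚ λ j → g j x) ≡ sumℚ λ j → sumOver xs (g j)
  sumOver-sumℚ {n} []       g = sym (Sumℚ.sum-replicate-zero n)
  sumOver-sumℚ     (x ∷ xs) g = trans (cong (_+_ (sumℚ λ j → g j x)) (sumOver-sumℚ xs g))
    (sym (Sumℚ.∑-distrib-+ (λ j → g j x) (λ j → sumOver xs (g j))))

-- Upper bound: rounding a fractional solution.

-- Every element of `S` contributes less than `½`. The first alternative accounts for an empty `S`,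
-- where both sides are 0 and strictness fails.
sum<half : ∀ {n} (S : Subset n) (f : Fin n → ℚ) → (∀ i → f i < ½) →
           (∀ i → i ∉ S → f i ≡ 0ℚ) → sumℚ f ≡ 0ℚ ⊎ sumℚ f < ⟦ ∣ S ∣ ⟧ * ½
sum<half []            f f<½ f≡0 = inj₁ refl
sum<half (outside ∷ S) f f<½ f≡0
  rewrite f≡0 zero (λ ()) | ℚ.+-identityˡ (sumℚ (f ∘ suc)) =
  sum<half S (f ∘ suc) (f<½ ∘ suc) λ i i∉S → f≡0 (suc i) (i∉S ∘ drop-there)
sum<half (inside ∷ S) f f<½ f≡0 = inj₂ (begin-strict
  f zero + sumℚ (f ∘ suc)   <⟨ ℚ.+-mono-<-≤ (f<½ zero) rest ⟩
  ½ + ⟦ ∣ S ∣ ⟧ * ½         ≡⟨ cong (λ h → h + ⟦ ∣ S ∣ ⟧ * ½) (ℚ.*-identityˡ ½) ⟨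
  1ℚ * ½ + ⟦ ∣ S ∣ ⟧ * ½    ≡⟨ ℚ.*-distribʳ-+ ½ 1ℚ ⟦ ∣ S ∣ ⟧ ⟨
  ⟦ suc ∣ S ∣ ⟧ * ½         ∎)
  where
  open ℚ.≤-Reasoning
  rest : sumℚ (f ∘ suc) ≤ ⟦ ∣ S ∣ ⟧ * ½
  rest with sum<half S (f ∘ suc) (f<½ ∘ suc) (λ i i∉S → f≡0 (suc i) (i∉S ∘ drop-there))
  ... | inj₁ eq = ℚ.≤-trans (ℚ.≤-reflexive eq)
    (ℚ.≤-trans (ℚ.≤-reflexive (sym (ℚ.*-zeroˡ ½))) (ℚ.*-monoʳ-≤-nonNeg ½ 0≤⟦ ∣ S ∣ ⟧))
  ... | inj₂ lt = ℚ.<⇒≤ lt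

-- Otherwise at most two nonzero entries, each below `½`, would have to add up to 1.
half-attained : ∀ {n} (S : Subset n) (f : Fin n → ℚ) → ∣ S ∣ ℕ.≤ 2 → sumℚ f ≡ 1ℚ →
                (∀ i → i ∉ S → f i ≡ 0ℚ) → ∃[ i ] ½ ≤ f i
half-attained S f ∣S∣≤2 sum≡1 f≡0 with Fin.any? (λ i → ½ ℚ.≤? f i)
... | yes found = found
... | no ∄ with sum<half S f (λ i → ℚ.≰⇒> λ ½≤ → ∄ (i , ½≤)) f≡0
...   | inj₁ sum≡0 = contradiction (trans (sym sum≡0) sum≡1) λ ()
...   | inj₂ sum<  = contradiction sum≡1 (ℚ.<⇒≢ (ℚ.<-≤-trans sum<
          (ℚ.*-monoʳ-≤-nonNeg ½ (⟦⟧-mono-≤ ∣S∣≤2))))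

p≤cost : ∀ I i {C j} → j ∈ C → p I i j ≤⁺ cost I i C
p≤cost I i {C} {j} j∈C = subst (_≤⁺ cost I i C)
  (if-yes (j ∈? C) j∈C)
  (sum∞-lookup (λ j → if does (j ∈? C) then p I i j else [ 0 ]) j)

cost-value : ∀ I i C {t} → cost I i C ≡ [ t ] →
             sumℚ (λ j → if does (j ∈? C) then ⟦ value (p I i j) ⟧ else 0ℚ) ≡ ⟦ t ⟧
cost-value I i C eq = trans
  (Sumℚ.sum-cong-≗ λ j → lemma (does (j ∈? C)) (p I i j))
  (sum∞-value (λ j → if does (j ∈? C) then p I i j else [ 0 ]) eq)
  where
  lemma : ∀ b x → (if b then ⟦ value x ⟧ else 0ℚ) ≡ ⟦ value (if b then x else [ 0 ]) ⟧
  lemma true  x = refl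
  lemma false x = refl

module Rounding {I : Instance} {T : ℕ} (lp : ConfigLP I T) where
  open ConfigLP lp

  configs : Machine I → List (Subset (#jobs I))
  configs = configurations I T

  configs-valid : ∀ i → All (IsConfiguration I T i) (configs i)
  configs-valid i = all-filter (isConfiguration? I T i) (subsets (#jobs I))

  share : Machine I → Job I → ℚ
  share i j = sumOver (filter (j ∈?_) (configs i)) (y i)

  -- A configuration containing `j` costs at least `p I i j`, so none of cost at most `T` contains
  -- it.
  share-0 : ∀ i j → ¬ p I i j ≤⁺ [ T ] → share i j ≡ 0ℚ
  share-0 i j p≰T = cong (λ Cs → sumOver Cs (y i)) (filter-none (j ∈?_)
    (All.map (λ cost≤T j∈C → p≰T (≤∞-trans (p≤cost I i j∈C) cost≤T)) (configs-valid i)))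

  weight : Machine I → Job I → ℚ
  weight i j = ⟦ value (p I i j) ⟧

  -- Exchanging the sums over jobs and configurations turns the fractional load into the average of
  -- the configuration costs with weights `y i C`. These weights add up to 1 and each cost is at
  -- most `T`.
  sum-share≤T : ∀ i → sumℚ (λ j → share i j * weight i j) ≤ ⟦ T ⟧
  sum-share≤T i = begin
    sumℚ (λ j → share i j * weight i j)
      ≡⟨ Sumℚ.sum-cong-≗ (λ j → trans (cong (_* weight i j) (sumOver-filter (j ∈?_) (configs i) (y i)))
           (sym (sumOver-*ʳ (configs i) _ (weight i j)))) ⟩
    sumℚ (λ j → sumOver (configs i) λ C → (if does (j ∈? C) then y i C else 0ℚ) * weight i j)
      ≡⟨ sumOver-sumℚ (configs i) (λ j C → (if does (j ∈? C) then y i C else 0ℚ) * weight i j) ⟨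
    sumOver (configs i) (λ C → sumℚ λ j → (if does (j ∈? C) then y i C else 0ℚ) * weight i j)
      ≡⟨ sumOver-cong (configs i) (λ C → trans
           (Sumℚ.sum-cong-≗ λ j → swap-if (does (j ∈? C)) (y i C) (weight i j))
           (sym (*-distribˡ-sum (y i C) λ j → if does (j ∈? C) then weight i j else 0ℚ))) ⟩
    sumOver (configs i) (λ C → y i C * sumℚ λ j → if does (j ∈? C) then weight i j else 0ℚ)
      ≤⟨ sumOver-mono (All.map (λ {C} → bound C) (configs-valid i)) ⟩
    sumOver (configs i) (λ C → y i C * ⟦ T ⟧)
      ≡⟨ sumOver-*ʳ (configs i) (y i) ⟦ T ⟧ ⟩
    sumOver (configs i) (y i) * ⟦ T ⟧
      ≡⟨ cong (_* ⟦ T ⟧) (perMachine i) ⟩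
    1ℚ * ⟦ T ⟧
      ≡⟨ ℚ.*-identityˡ ⟦ T ⟧ ⟩
    ⟦ T ⟧ ∎
    where
    open ℚ.≤-Reasoning
    swap-if : ∀ b u v → (if b then u else 0ℚ) * v ≡ u * (if b then v else 0ℚ)
    swap-if true  u v = refl
    swap-if false u v = trans (ℚ.*-zeroˡ v) (sym (ℚ.*-zeroʳ u))

    bound : ∀ C → IsConfiguration I T i C →
            y i C * sumℚ (λ j → if does (j ∈? C) then weight i j else 0ℚ) ≤ y i C * ⟦ T ⟧
    bound C valid with cost I i C in eq | valid
    ... | [ t ] | [ t≤T ] = ℚ.*-monoˡ-≤-nonNeg (y i C)
      {{ℚ.nonNegative (nonneg i C (subst (_≤⁺ [ T ]) (sym eq) [ t≤T ]))}}
      (ℚ.≤-trans (ℚ.≤-reflexive (cost-value I i C eq)) (⟦⟧-mono-≤ t≤T))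

  module _ (ugb : UnrelatedGraphBalancing I) where

    majority : ∀ j → ∃[ i ] ½ ≤ share i j
    majority j = half-attained (finiteMachines I j) (λ i → share i j) (ugb j) (perJob j)
      λ i i∉ → share-0 i j λ p≤T → i∉ (∈-tabulate⁺ (λ i → finite? (p I i j)) (≤⁺⇒finite p≤T))
      where
      ≤⁺⇒finite : ∀ {x t} → x ≤⁺ [ t ] → Finite x
      ≤⁺⇒finite [ _ ] = finite

    σ : Schedule I
    σ = proj₁ ∘ majority

    -- A share of at least `½` is not 0, so `share-0` excludes a processing time above `T`.
    p-σ≤T : ∀ j → p I (σ j) j ≤⁺ [ T ]
    p-σ≤T j with ≤⁺-dec ℕ._≤?_ (p I (σ j) j) [ T ]
    ... | yes p≤T = p≤T
    ... | no p≰T  = contradiction (subst (½ ≤_) (share-0 (σ j) j p≰T) (proj₂ (majority j)))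
      (toWitnessFalse {a? = ½ ℚ.≤? 0ℚ} _)

    -- A job moved to `i` already had share at least `½` there, so its full time is at most twice
    -- its fractional time; summing gives twice the bound of `sum-share≤T`.
    cost-σ≤2T : ∀ i → cost I i (jobsOn I σ i) ≤⁺ [ 2 ℕ.* T ]
    cost-σ≤2T i = subst (_≤⁺ [ 2 ℕ.* T ]) (sym cost≡t) [ ⟦⟧-cancel-≤ (begin
      ⟦ t ⟧
        ≡⟨ cost-value I i D cost≡t ⟨
      sumℚ (λ j → if does (j ∈? D) then weight i j else 0ℚ)
        ≤⟨ sumℚ-mono term ⟩
      sumℚ (λ j → ⟦ 2 ⟧ * (share i j * weight i j))
        ≡⟨ *-distribˡ-sum ⟦ 2 ⟧ (λ j → share i j * weight i j) ⟨
      ⟦ 2 ⟧ * sumℚ (λ j → share i j * weight i j)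
        ≤⟨ ℚ.*-monoˡ-≤-nonNeg ⟦ 2 ⟧ (sum-share≤T i) ⟩
      ⟦ 2 ⟧ * ⟦ T ⟧
        ≡⟨ ×1-homo-* 2 T ⟨
      ⟦ 2 ℕ.* T ⟧ ∎) ]
      where
      open ℚ.≤-Reasoning

      D : Subset (#jobs I)
      D = jobsOn I σ i

      ∈D⇒σ : ∀ {j} → j ∈ D → σ j ≡ i
      ∈D⇒σ = ∈-tabulate⁻ (λ j → σ j Fin.≟ i)

      -- By `p-σ≤T` all assigned times are finite, so the load is a natural number and the estimate
      -- can be made in ℚ.
      cost-finite : ∃[ t ] cost I i D ≡ [ t ]
      cost-finite = sum∞-finite _ λ j → entry j
        where
        entry : ∀ j → Finite (if does (j ∈? D) then p I i j else [ 0 ])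
        entry j with j ∈? D
        ... | no _    = finite
        ... | yes j∈D with p I i j | subst (λ i → p I i j ≤⁺ [ T ]) (∈D⇒σ j∈D) (p-σ≤T j)
        ...   | [ _ ] | _ = finite

      t = proj₁ cost-finite
      cost≡t = proj₂ cost-finite

      0≤share : ∀ j → 0ℚ ≤ share i j
      0≤share j = begin
        0ℚ
          ≡⟨ sumOver-0 (configs i) ⟨
        sumOver (configs i) (λ _ → 0ℚ)
          ≤⟨ sumOver-mono (All.map (λ {C} → entry C) (configs-valid i)) ⟩
        sumOver (configs i) (λ C → if does (j ∈? C) then y i C else 0ℚ)
          ≡⟨ sumOver-filter (j ∈?_) (configs i) (y i) ⟨
        share i j ∎
        where
        entry : ∀ C → IsConfiguration I T i C → 0ℚ ≤ (if does (j ∈? C) then y i C else 0ℚ)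
        entry C valid with does (j ∈? C)
        ... | true  = nonneg i C valid
        ... | false = ℚ.≤-refl

      0≤weight : ∀ j → ℚ.NonNegative (weight i j)
      0≤weight j = ℚ.nonNegative 0≤⟦ value (p I i j) ⟧

      half≤share : ∀ {j} → j ∈ D → ½ ≤ share i j
      half≤share {j} j∈D = subst (λ i → ½ ≤ share i j) (∈D⇒σ j∈D) (proj₂ (majority j))

      term : ∀ j → (if does (j ∈? D) then weight i j else 0ℚ) ≤ ⟦ 2 ⟧ * (share i j * weight i j)
      term j with j ∈? D
      ... | yes j∈D = begin
        weight i j
          ≡⟨ ℚ.*-identityˡ (weight i j) ⟨
        (⟦ 2 ⟧ * ½) * weight i j
          ≤⟨ ℚ.*-monoʳ-≤-nonNeg (weight i j) {{0≤weight j}}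
               (ℚ.*-monoˡ-≤-nonNeg ⟦ 2 ⟧ (half≤share j∈D)) ⟩
        (⟦ 2 ⟧ * share i j) * weight i j
          ≡⟨ ℚ.*-assoc ⟦ 2 ⟧ (share i j) (weight i j) ⟩
        ⟦ 2 ⟧ * (share i j * weight i j) ∎
      ... | no _    = begin
        0ℚ
          ≡⟨ cong (⟦ 2 ⟧ *_) (ℚ.*-zeroˡ (weight i j)) ⟨
        ⟦ 2 ⟧ * (0ℚ * weight i j)
          ≤⟨ ℚ.*-monoˡ-≤-nonNeg ⟦ 2 ⟧
               (ℚ.*-monoʳ-≤-nonNeg (weight i j) {{0≤weight j}} (0≤share j)) ⟩
        ⟦ 2 ⟧ * (share i j * weight i j) ∎

minMakespan≤2T : ∀ {I c T} → UnrelatedGraphBalancing I → IsMinMakespan I c →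
                 ConfigLP I T → c ℕ.≤ 2 ℕ.* T
minMakespan≤2T {I} ugb (_ , minimal) lp = [≤]-injective
  (≤∞-trans (minimal (σ ugb)) (max∞-lub (λ i → cost I i (jobsOn I (σ ugb) i)) (cost-σ≤2T ugb)))
  where open Rounding lp

-- LP solutions from weighted lists of configurations.

module _ {A : Set} where

  sumOver-++ : ∀ (xs ys : List A) f → sumOver (xs ++ ys) f ≡ sumOver xs f + sumOver ys f
  sumOver-++ []       ys f = sym (ℚ.+-identityˡ _)
  sumOver-++ (x ∷ xs) ys f = trans (cong (_+_ (f x)) (sumOver-++ xs ys f)) (sym (ℚ.+-assoc (f x) _ _))

  sumOver-map : ∀ {B : Set} (g : B → A) xs f → sumOver (List.map g xs) f ≡ sumOver xs (f ∘ g)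
  sumOver-map g []       f = refl
  sumOver-map g (x ∷ xs) f = cong (_+_ (f (g x))) (sumOver-map g xs f)

_≟ˢ_ : ∀ {n} (C D : Subset n) → Dec (C ≡ D)
_≟ˢ_ = ≡-dec Bool._≟_

-- `subsets n` lists each subset exactly once: the head of `S` selects one half of the list, and the
-- other half contributes 0.
sumOver-subsets : ∀ {n} (S : Subset n) (g : Subset n → ℚ) →
                  sumOver (subsets n) (λ C → if does (C ≟ˢ S) then g C else 0ℚ) ≡ g S
sumOver-subsets {zero}  []      g = ℚ.+-identityʳ (g [])
sumOver-subsets {suc n} (s ∷ S) g = trans (sumOver-++ (List.map (outside ∷_) (subsets n)) _ _)
  (trans (cong₂ _+_ (sumOver-map (outside ∷_) (subsets n) _) (sumOver-map (inside ∷_) (subsets n) _))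
    (by-head s))
  where
  by-head : ∀ s → sumOver (subsets n) (λ C → if does ((outside ∷ C) ≟ˢ (s ∷ S)) then g (outside ∷ C) else 0ℚ)
                + sumOver (subsets n) (λ C → if does ((inside ∷ C) ≟ˢ (s ∷ S)) then g (inside ∷ C) else 0ℚ)
                ≡ g (s ∷ S)
  by-head outside = trans
    (cong₂ _+_ (sumOver-subsets S (g ∘ (outside ∷_))) (sumOver-0 (subsets n)))
    (ℚ.+-identityʳ _)
  by-head inside  = trans
    (cong₂ _+_ (sumOver-0 (subsets n)) (sumOver-subsets S (g ∘ (inside ∷_))))
    (ℚ.+-identityˡ _)

if-sumℚ : ∀ {n} b (f : Fin n → ℚ) → (if b then sumℚ f else 0ℚ) ≡ sumℚ (λ i → if b then f i else 0ℚ)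
if-sumℚ     true  f = refl
if-sumℚ {n} false f = sym (Sumℚ.sum-replicate-zero n)

sumℚ-nonneg : ∀ {n} (f : Fin n → ℚ) → (∀ i → 0ℚ ≤ f i) → 0ℚ ≤ sumℚ f
sumℚ-nonneg {zero}  f 0≤f = ℚ.≤-refl
sumℚ-nonneg {suc n} f 0≤f = ℚ.+-mono-≤ (0≤f zero) (sumℚ-nonneg (f ∘ suc) (0≤f ∘ suc))

module _ {I : Instance} {T L : ℕ}
  (w : Machine I → Fin L → ℚ) (S : Machine I → Fin L → Subset (#jobs I))
  (w-nonneg : ∀ i l → 0ℚ ≤ w i l) (S-valid : ∀ i l → IsConfiguration I T i (S i l)) where

  private
    -- The same configuration may occur at several positions `l`; their weights are added.
    y : Machine I → Subset (#jobs I) → ℚ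
    y i C = sumℚ λ l → if does (C ≟ˢ S i l) then w i l else 0ℚ

    y-nonneg : ∀ i C → 0ℚ ≤ y i C
    y-nonneg i C = sumℚ-nonneg _ entry
      where
      entry : ∀ l → 0ℚ ≤ (if does (C ≟ˢ S i l) then w i l else 0ℚ)
      entry l with does (C ≟ˢ S i l)
      ... | true  = w-nonneg i l
      ... | false = ℚ.≤-refl

    valid? : ∀ i C → Dec (IsConfiguration I T i C)
    valid? i = isConfiguration? I T i

    -- The test `b` serves both LP constraints: constantly true for a machine, membership of a job
    -- for that job. Validity of each `S i l` guarantees that filtering by cost loses no weight.
    sum-y : ∀ i (b : Subset (#jobs I) → Bool) →
            sumOver (configurations I T i) (λ C → if b C then y i C else 0ℚ) ≡
            sumℚ λ l → if b (S i l) then w i l else 0ℚ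
    sum-y i b = begin
      sumOver (configurations I T i) (λ C → if b C then y i C else 0ℚ)
        ≡⟨ sumOver-filter (valid? i) (subsets (#jobs I)) _ ⟩
      sumOver (subsets (#jobs I)) (λ C → if does (valid? i C) then (if b C then y i C else 0ℚ) else 0ℚ)
        ≡⟨ sumOver-cong (subsets (#jobs I)) pointwise ⟩
      sumOver (subsets (#jobs I)) (λ C → sumℚ λ l → if does (C ≟ˢ S i l) then select l C else 0ℚ)
        ≡⟨ sumOver-sumℚ (subsets (#jobs I)) (λ l C → if does (C ≟ˢ S i l) then select l C else 0ℚ) ⟩
      sumℚ (λ l → sumOver (subsets (#jobs I)) λ C → if does (C ≟ˢ S i l) then select l C else 0ℚ)
        ≡⟨ Sumℚ.sum-cong-≗ (λ l → trans (sumOver-subsets (S i l) (select l))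
             (if-yes (valid? i (S i l)) (S-valid i l))) ⟩
      sumℚ (λ l → if b (S i l) then w i l else 0ℚ) ∎
      where
      open ≡-Reasoning
      select : Fin L → Subset (#jobs I) → ℚ
      select l C = if does (valid? i C) then (if b C then w i l else 0ℚ) else 0ℚ

      swap-ifs : ∀ u v s x → (if u then (if v then (if s then x else 0ℚ) else 0ℚ) else 0ℚ)
                           ≡ (if s then (if u then (if v then x else 0ℚ) else 0ℚ) else 0ℚ)
      swap-ifs true  true  s     x = refl
      swap-ifs true  false true  x = refl
      swap-ifs true  false false x = refl
      swap-ifs false v     true  x = refl
      swap-ifs false v     false x = refl

      pointwise : ∀ C → (if does (valid? i C) then (if b C then y i C else 0ℚ) else 0ℚ)
                      ≡ sumℚ λ l → if does (C ≟ˢ S i l) then select l C else 0ℚ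
      pointwise C = trans (cong (λ s → if does (valid? i C) then s else 0ℚ)
          (if-sumℚ (b C) λ l → if does (C ≟ˢ S i l) then w i l else 0ℚ))
        (trans (if-sumℚ (does (valid? i C)) λ l → if b C then (if does (C ≟ˢ S i l) then w i l else 0ℚ) else 0ℚ)
          (Sumℚ.sum-cong-≗ λ l → swap-ifs (does (valid? i C)) (b C) (does (C ≟ˢ S i l)) (w i l)))

  mixture : (∀ i → sumℚ (w i) ≡ 1ℚ) →
            (∀ j → sumℚ (λ i → sumℚ λ l → if does (j ∈? S i l) then w i l else 0ℚ) ≡ 1ℚ) →
            ConfigLP I T
  mixture mass covers = record
    { y          = y
    ; nonneg     = λ i C _ → y-nonneg i C
    ; perMachine = λ i → trans (sum-y i λ _ → true) (mass i)
    ; perJob     = λ j → trans (Sumℚ.sum-cong-≗ λ i →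
        trans (sumOver-filter (j ∈?_) (configurations I T i) (y i)) (sum-y i λ C → does (j ∈? C))) (covers j)
    }

-- Small subsets, and costs of enumerated sets of jobs.

∣p∪q∣≤∣p∣+∣q∣ : ∀ {n} (p q : Subset n) → ∣ p ∪ q ∣ ℕ.≤ ∣ p ∣ ℕ.+ ∣ q ∣
∣p∪q∣≤∣p∣+∣q∣ []            []            = z≤n
∣p∪q∣≤∣p∣+∣q∣ (outside ∷ p) (outside ∷ q) = ∣p∪q∣≤∣p∣+∣q∣ p q
∣p∪q∣≤∣p∣+∣q∣ (outside ∷ p) (inside  ∷ q) =
  ℕ.≤-trans (s≤s (∣p∪q∣≤∣p∣+∣q∣ p q)) (ℕ.≤-reflexive (sym (ℕ.+-suc ∣ p ∣ ∣ q ∣)))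
∣p∪q∣≤∣p∣+∣q∣ (inside  ∷ p) (outside ∷ q) = s≤s (∣p∪q∣≤∣p∣+∣q∣ p q)
∣p∪q∣≤∣p∣+∣q∣ (inside  ∷ p) (inside  ∷ q) =
  s≤s (ℕ.≤-trans (∣p∪q∣≤∣p∣+∣q∣ p q) (ℕ.+-monoʳ-≤ ∣ p ∣ (ℕ.n≤1+n ∣ q ∣)))

⊆pair⇒∣p∣≤2 : ∀ {n} (p : Subset n) a b → (∀ i → i ∈ p → i ≡ a ⊎ i ≡ b) → ∣ p ∣ ℕ.≤ 2
⊆pair⇒∣p∣≤2 p a b p⊆ab = ℕ.≤-trans
  (p⊆q⇒∣p∣≤∣q∣ {q = ⁅ a ⁆ ∪ ⁅ b ⁆} λ {i} i∈p → x∈p∪q⁺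
    ([ (λ { refl → inj₁ (x∈⁅x⁆ a) }) , (λ { refl → inj₂ (x∈⁅x⁆ b) }) ]′ (p⊆ab i i∈p)))
  (ℕ.≤-trans (∣p∪q∣≤∣p∣+∣q∣ ⁅ a ⁆ ⁅ b ⁆) (ℕ.≤-reflexive (cong₂ ℕ._+_ (∣⁅x⁆∣≡1 a) (∣⁅x⁆∣≡1 b))))

image : ∀ {l n} → (Fin l → Fin n) → Subset n
image e = tabulate λ j → does (Fin.any? λ a → e a Fin.≟ j)

∈-image⁺ : ∀ {l n} (e : Fin l → Fin n) a → e a ∈ image e
∈-image⁺ e a = ∈-tabulate⁺ (λ j → Fin.any? λ a → e a Fin.≟ j) (a , refl)

∈-image⁻ : ∀ {l n} (e : Fin l → Fin n) {j} → j ∈ image e → ∃[ a ] e a ≡ j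
∈-image⁻ e = ∈-tabulate⁻ (λ j → Fin.any? λ a → e a Fin.≟ j)

-- For an upper bound the enumeration `e` may repeat jobs or leave `C`.
cost-cover : ∀ I i {C l} (e : Fin l → Job I) → (∀ {j} → j ∈ C → ∃[ a ] e a ≡ j) →
             cost I i C ≤⁺ sum∞ (p I i ∘ e)
cost-cover I i {C} e cover = ≤∞-trans (sum∞-cover e entry split) (sum∞-mono (λ a → entry≤p (e a)))
  where
  entry : Job I → ℕ∞
  entry j = if does (j ∈? C) then p I i j else [ 0 ]

  split : ∀ j → entry j ≡ [ 0 ] ⊎ ∃[ a ] e a ≡ j
  split j with j ∈? C
  ... | yes j∈C = inj₂ (cover j∈C)
  ... | no _    = inj₁ refl

  entry≤p : ∀ j → entry j ≤⁺ p I i j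
  entry≤p j with does (j ∈? C)
  ... | true  = ≤∞-refl
  ... | false = 0≤∞

-- The counterpart of `cost-cover` for lower bounds: the jobs listed must be distinct and assigned
-- to `i`, but need not be all of them.
makespan-injective : ∀ I σ i {l} (e : Fin l → Job I) → (∀ {a b} → e a ≡ e b → a ≡ b) →
                     (∀ a → σ (e a) ≡ i) → sum∞ (p I i ∘ e) ≤⁺ makespan I σ
makespan-injective I σ i e inj on-i = ≤∞-trans
  (subst (_≤⁺ cost I i (jobsOn I σ i)) (Sum∞.sum-cong-≗ λ a →
      if-yes (e a ∈? jobsOn I σ i) (∈-tabulate⁺ (λ j → σ j Fin.≟ i) (on-i a)))
    (sum∞-injective e (λ j → if does (j ∈? jobsOn I σ i) then p I i j else [ 0 ]) inj))
  (max∞-lookup (λ i → cost I i (jobsOn I σ i)) i)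

sum∞-const : ∀ n c → sum∞ {n} (λ _ → [ c ]) ≡ [ n ℕ.* c ]
sum∞-const zero    c = refl
sum∞-const (suc n) c = cong ([ c ] +∞_) (sum∞-const n c)

sumℚ-const : ∀ n c → sumℚ {n} (λ _ → c) ≡ ⟦ n ⟧ * c
sumℚ-const zero    c = sym (ℚ.*-zeroˡ c)
sumℚ-const (suc n) c = trans (cong (_+_ c) (sumℚ-const n c))
  (trans (cong (_+ ⟦ n ⟧ * c) (sym (ℚ.*-identityˡ c))) (sym (ℚ.*-distribʳ-+ c 1ℚ ⟦ n ⟧)))

-- The k-ary tree and the decay of weights along it.

-- Nodes of the infinite k-ary tree are numbered level by level from the
-- root 0, so that the children of n are k n + 1, …, k n + k.
module Heap (k : ℕ) {{_ : ℕ.NonZero k}} where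

  -- The parent of `suc n` is `n / k`, which is not structurally smaller, hence the fuel. Fuel `n`
  -- suffices for node `n` because `n / k` is at most `n`.
  depthWithin : ℕ → ℕ → ℕ
  depthWithin fuel    zero    = 0
  depthWithin zero    (suc n) = 0
  depthWithin (suc f) (suc n) = suc (depthWithin f (n ℕ./ k))

  depth : ℕ → ℕ
  depth n = depthWithin n n

  depthWithin-irrelevant : ∀ f g n → n ℕ.≤ f → n ℕ.≤ g → depthWithin f n ≡ depthWithin g n
  depthWithin-irrelevant f       g       zero    _         _         = refl
  depthWithin-irrelevant (suc f) (suc g) (suc n) (s≤s n≤f) (s≤s n≤g) = cong suc
    (depthWithin-irrelevant f g (n ℕ./ k)
      (ℕ.≤-trans (ℕ.m/n≤m n k) n≤f) (ℕ.≤-trans (ℕ.m/n≤m n k) n≤g))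

  depth-suc : ∀ n → depth (suc n) ≡ suc (depth (n ℕ./ k))
  depth-suc n = cong suc (depthWithin-irrelevant n (n ℕ./ k) (n ℕ./ k) (ℕ.m/n≤m n k) ℕ.≤-refl)

  -- The number of nodes of depth less than N.
  size : ℕ → ℕ
  size zero    = 0
  size (suc N) = suc (size N ℕ.* k)

  -- Passing to the parent maps indices above `size N * k` to indices from `size N` on, which loses
  -- one level.
  depth-≥ : ∀ N n → size N ℕ.≤ n → N ℕ.≤ depth n
  depth-≥ zero    n       _         = z≤n
  depth-≥ (suc N) (suc n) (s≤s le) = subst (suc N ℕ.≤_) (sym (depth-suc n))
    (s≤s (depth-≥ N (n ℕ./ k) (ℕ.≤-trans (ℕ.≤-reflexive (sym (ℕ.m*n/n≡m (size N) k))) (ℕ./-monoˡ-≤ k le))))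

-- The decay by 1 − 1/k per level beats the harmonic bound K / (K + d), which
-- falls to 1/k at depth K².
module Decay (K : ℕ) where

  k : ℕ
  k = suc K

  0<⟦k⟧ : 0ℚ < ⟦ k ⟧
  0<⟦k⟧ = ⟦⟧-mono-< {0} {k} (s≤s z≤n)

  instance
    ⟦k⟧-positive : ℚ.Positive ⟦ k ⟧
    ⟦k⟧-positive = ℚ.positive 0<⟦k⟧

    ⟦k⟧-nonZero : ℚ.NonZero ⟦ k ⟧
    ⟦k⟧-nonZero = ℚ.pos⇒nonZero ⟦ k ⟧

  κ α : ℚ
  κ = ℚ.1/ ⟦ k ⟧
  α = 1ℚ - κ

  ⟦k⟧*κ≡1 : ⟦ k ⟧ * κ ≡ 1ℚ
  ⟦k⟧*κ≡1 = ℚ.*-inverseʳ ⟦ k ⟧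

  0≤κ : 0ℚ ≤ κ
  0≤κ = ℚ.<⇒≤ (ℚ.positive⁻¹ κ {{ℚ.1/pos⇒pos ⟦ k ⟧}})

  ⟦k⟧*α≡⟦K⟧ : ⟦ k ⟧ * α ≡ ⟦ K ⟧
  ⟦k⟧*α≡⟦K⟧ = begin
    ⟦ k ⟧ * (1ℚ - κ)     ≡⟨ solve 2 (λ a b → a :* (con 1ℚ :- b) := a :- a :* b) refl ⟦ k ⟧ κ ⟩
    ⟦ k ⟧ - ⟦ k ⟧ * κ    ≡⟨ cong (⟦ k ⟧ -_) ⟦k⟧*κ≡1 ⟩
    (1ℚ + ⟦ K ⟧) - 1ℚ    ≡⟨ solve 1 (λ a → (con 1ℚ :+ a) :- con 1ℚ := a) refl ⟦ K ⟧ ⟩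
    ⟦ K ⟧                ∎
    where
    open ≡-Reasoning
    open +-*-Solver using (solve; con; _:+_; _:-_; _:*_; _:=_)

  0≤α : 0ℚ ≤ α
  0≤α = ℚ.*-cancelˡ-≤-pos ⟦ k ⟧ (ℚ.≤-trans (ℚ.≤-reflexive (ℚ.*-zeroʳ ⟦ k ⟧))
    (ℚ.≤-trans 0≤⟦ K ⟧ (ℚ.≤-reflexive (sym ⟦k⟧*α≡⟦K⟧))))

  α≤1 : α ≤ 1ℚ
  α≤1 = ℚ.≤-trans (ℚ.+-monoʳ-≤ 1ℚ (ℚ.neg-antimono-≤ 0≤κ)) (ℚ.≤-reflexive (ℚ.+-identityʳ 1ℚ))

  decay : ℕ → ℚ
  decay zero    = 1ℚ
  decay (suc d) = α * decay d

  0≤decay : ∀ d → 0ℚ ≤ decay d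
  0≤decay zero    = ℚ.nonNegative⁻¹ 1ℚ
  0≤decay (suc d) = ℚ.≤-trans (ℚ.≤-reflexive (sym (ℚ.*-zeroʳ α)))
    (ℚ.*-monoˡ-≤-nonNeg α {{ℚ.nonNegative 0≤α}} (0≤decay d))

  decay≤1 : ∀ d → decay d ≤ 1ℚ
  decay≤1 zero    = ℚ.≤-refl
  decay≤1 (suc d) = ℚ.≤-trans (ℚ.*-monoʳ-≤-nonNeg (decay d) {{ℚ.nonNegative (0≤decay d)}} α≤1)
    (ℚ.≤-trans (ℚ.≤-reflexive (ℚ.*-identityˡ (decay d))) (decay≤1 d))

  -- After multiplication by `k`, the identity k α = K reduces the step to K (K + d + 1) ≤ (K + 1)
  -- (K + d), whose sides differ by `d`.
  harmonic : ∀ d → ⟦ K ℕ.+ d ⟧ * decay d ≤ ⟦ K ⟧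
  harmonic zero    = ℚ.≤-reflexive (trans (ℚ.*-identityʳ _) (cong ⟦_⟧ (ℕ.+-identityʳ K)))
  harmonic (suc d) = ℚ.*-cancelˡ-≤-pos ⟦ k ⟧ (begin
    ⟦ k ⟧ * (⟦ K ℕ.+ suc d ⟧ * (α * decay d))
      ≡⟨ solve 4 (λ a b c e → a :* (b :* (c :* e)) := (a :* c) :* b :* e) refl ⟦ k ⟧ ⟦ K ℕ.+ suc d ⟧ α (decay d) ⟩
    (⟦ k ⟧ * α) * ⟦ K ℕ.+ suc d ⟧ * decay d
      ≡⟨ cong (λ s → s * ⟦ K ℕ.+ suc d ⟧ * decay d) ⟦k⟧*α≡⟦K⟧ ⟩
    ⟦ K ⟧ * ⟦ K ℕ.+ suc d ⟧ * decay d
      ≡⟨ cong (_* decay d) (×1-homo-* K (K ℕ.+ suc d)) ⟨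
    ⟦ K ℕ.* (K ℕ.+ suc d) ⟧ * decay d
      ≤⟨ ℚ.*-monoʳ-≤-nonNeg (decay d) {{ℚ.nonNegative (0≤decay d)}} (⟦⟧-mono-≤ nat) ⟩
    ⟦ k ℕ.* (K ℕ.+ d) ⟧ * decay d
      ≡⟨ cong (_* decay d) (×1-homo-* k (K ℕ.+ d)) ⟩
    ⟦ k ⟧ * ⟦ K ℕ.+ d ⟧ * decay d
      ≡⟨ ℚ.*-assoc ⟦ k ⟧ ⟦ K ℕ.+ d ⟧ (decay d) ⟩
    ⟦ k ⟧ * (⟦ K ℕ.+ d ⟧ * decay d)
      ≤⟨ ℚ.*-monoˡ-≤-nonNeg ⟦ k ⟧ {{ℚ.nonNegative 0≤⟦ k ⟧}} (harmonic d) ⟩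
    ⟦ k ⟧ * ⟦ K ⟧ ∎)
    where
    open ℚ.≤-Reasoning
    open +-*-Solver using (solve; con; _:+_; _:-_; _:*_; _:=_)
    nat : K ℕ.* (K ℕ.+ suc d) ℕ.≤ k ℕ.* (K ℕ.+ d)
    nat = ℕ.≤-trans (ℕ.≤-reflexive (trans (cong (K ℕ.*_) (ℕ.+-suc K d)) (ℕ.*-suc K (K ℕ.+ d))))
      (ℕ.+-monoˡ-≤ (K ℕ.* (K ℕ.+ d)) (ℕ.m≤m+n K d))

  -- For d ≥ K² one has K k = K + K² ≤ K + d, so `harmonic` bounds K k `decay d` by K, and K
  -- cancels.
  decay-small : .{{_ : ℕ.NonZero K}} → ∀ d → K ℕ.* K ℕ.≤ d → ⟦ k ⟧ * decay d ≤ 1ℚ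
  decay-small d K²≤d = ℚ.*-cancelˡ-≤-pos ⟦ K ⟧ {{ℚ.positive (⟦⟧-mono-< (ℕ.>-nonZero⁻¹ K))}} (begin
    ⟦ K ⟧ * (⟦ k ⟧ * decay d)      ≡⟨ ℚ.*-assoc ⟦ K ⟧ ⟦ k ⟧ (decay d) ⟨
    ⟦ K ⟧ * ⟦ k ⟧ * decay d        ≡⟨ cong (_* decay d) (×1-homo-* K k) ⟨
    ⟦ K ℕ.* k ⟧ * decay d          ≤⟨ ℚ.*-monoʳ-≤-nonNeg (decay d) {{ℚ.nonNegative (0≤decay d)}} (⟦⟧-mono-≤
                                       (ℕ.≤-trans (ℕ.≤-reflexive (ℕ.*-suc K K)) (ℕ.+-monoʳ-≤ K K²≤d))) ⟩
    ⟦ K ℕ.+ d ⟧ * decay d          ≤⟨ harmonic d ⟩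
    ⟦ K ⟧                          ≡⟨ ℚ.*-identityʳ ⟦ K ⟧ ⟨
    ⟦ K ⟧ * 1ℚ                     ∎)
    where open ℚ.≤-Reasoning

0≤1-p : ∀ {p} → p ≤ 1ℚ → 0ℚ ≤ 1ℚ - p
0≤1-p {p} p≤1 = ℚ.≤-trans (ℚ.≤-reflexive (sym (ℚ.+-inverseʳ p))) (ℚ.+-monoˡ-≤ (ℚ.- p) p≤1)

-- Lower bound: the tree instance.

module Gap (K #internal : ℕ) {{_ : ℕ.NonZero K}}
           (deep : ∀ n → #internal ℕ.≤ n → K ℕ.* K ℕ.≤ Heap.depth (suc K) n) where

  open Decay K
  open Heap k

  -- The root together with the `k` children of each of the first `#internal` nodes. The remaining
  -- nodes are leaves, and `deep` puts them at depth at least K².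
  m : ℕ
  m = suc (#internal ℕ.* k)

  #internal≤m : #internal ℕ.≤ m
  #internal≤m = ℕ.m≤n⇒m≤1+n (ℕ.m≤m*n #internal k)

  Node : Set
  Node = Fin m

  -- For uniform indexing every node gets an extra machine; that of an internal node has infinite
  -- time on every job.
  tree aux : Node → Fin (m ℕ.+ m)
  tree a = a ↑ˡ m
  aux  a = m ↑ʳ a

  child : Node → Fin k → Fin (suc (m ℕ.* k))
  child a r = suc (combine a r)

  -- The second machine of the job child a r: the child node if a is internal,
  -- and otherwise the extra machine of a, which all child jobs of a share.
  childMachine′ : ∀ a → Dec (toℕ a ℕ.< #internal) → Fin k → Fin (m ℕ.+ m)
  childMachine′ a (yes a<G) r = tree (suc (combine (fromℕ< a<G) r))
  childMachine′ a (no _)    r = aux a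

  childMachine : Node → Fin k → Fin (m ℕ.+ m)
  childMachine a = childMachine′ a (toℕ a ℕ.<? #internal)

  edge : Fin (m ℕ.+ m) → Node → Fin k → ℕ∞
  edge i a r = if does (i Fin.≟ tree a) then [ 1 ] else
               if does (i Fin.≟ childMachine a r) then [ K ] else ∞

  time : Fin (m ℕ.+ m) → Fin (suc (m ℕ.* k)) → ℕ∞
  time i zero    = if does (i Fin.≟ tree zero) then [ k ] else ∞
  time i (suc j) = edge i (quotient {m} k j) (remainder {m} k j)

  time-child : ∀ i a r → time i (child a r) ≡ edge i a r
  time-child i a r = cong (λ ar → edge i (proj₁ ar) (proj₂ ar)) (Fin.remQuot-combine {m} {k} a r)

  -- The index `i` stands for the non-root node `suc i`, which is child number `rank i` of
  -- `parent i`.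
  parent : Fin (#internal ℕ.* k) → Node
  parent i = inject≤ (quotient {#internal} k i) #internal≤m

  rank : Fin (#internal ℕ.* k) → Fin k
  rank = remainder {#internal} k

  -- The job of the edge to the parent, or the root job.
  up : Node → Fin (suc (m ℕ.* k))
  up zero    = zero
  up (suc i) = child (parent i) (rank i)

  data JobView (j : Fin (suc (m ℕ.* k))) : Set where
    root  : j ≡ zero → JobView j
    below : ∀ a r → j ≡ child a r → JobView j

  jobView : ∀ j → JobView j
  jobView zero    = root refl
  jobView (suc j) = below (quotient {m} k j) (remainder {m} k j)
    (cong suc (sym (Fin.combine-remQuot {m} k j)))

  data MachineView (i : Fin (m ℕ.+ m)) : Set where
    is-tree : ∀ a → i ≡ tree a → MachineView i
    is-aux  : ∀ a → i ≡ aux a → MachineView i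

  machineView : ∀ i → MachineView i
  machineView i with splitAt m i | Fin.join-splitAt m m i
  ... | inj₁ a | eq = is-tree a (sym eq)
  ... | inj₂ a | eq = is-aux a (sym eq)

  tree-injective : ∀ {a b} → tree a ≡ tree b → a ≡ b
  tree-injective = Fin.↑ˡ-injective m _ _

  aux-injective : ∀ {a b} → aux a ≡ aux b → a ≡ b
  aux-injective = Fin.↑ʳ-injective m _ _

  tree≢aux : ∀ {a b} → tree a ≢ aux b
  tree≢aux {a} {b} eq
    with trans (sym (Fin.splitAt-↑ˡ m a m)) (trans (cong (splitAt m) eq) (Fin.splitAt-↑ʳ m m b))
  ... | ()

  child-injective : ∀ {a b r s} → child a r ≡ child b s → a ≡ b × r ≡ s
  child-injective {a} {b} {r} {s} eq = Fin.combine-injective a r b s (Fin.suc-injective eq)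

  -- For an internal node, each child job is the up job of a node of larger index; the inequality
  -- drives the induction from the leaves to the root.
  data NodeView (a : Node) : Set where
    internal : (∀ r → ∃[ i ] (childMachine a r ≡ tree (suc i) × up (suc i) ≡ child a r ×
                              toℕ a ℕ.< toℕ (suc i))) → NodeView a
    leaf     : #internal ℕ.≤ toℕ a → (∀ r → childMachine a r ≡ aux a) → NodeView a

  nodeView : ∀ a → NodeView a
  nodeView a with toℕ a ℕ.<? #internal in eq
  ... | no a≮G  = leaf (ℕ.≮⇒≥ a≮G) λ r → cong (λ d → childMachine′ a d r) eq
  ... | yes a<G = internal λ r → combine (fromℕ< a<G) r , cong (λ d → childMachine′ a d r) eq ,
    cong₂ child (inject-quotient r) (cong proj₂ (Fin.remQuot-combine (fromℕ< a<G) r)) , s≤s (a≤combine r)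
    where
    inject-quotient : ∀ r → inject≤ (quotient {#internal} k (combine (fromℕ< a<G) r)) #internal≤m ≡ a
    inject-quotient r = trans
      (cong (λ q → inject≤ (proj₁ q) #internal≤m) (Fin.remQuot-combine (fromℕ< a<G) r))
      (Fin.toℕ-injective (trans (Fin.toℕ-inject≤ (fromℕ< a<G) #internal≤m) (Fin.toℕ-fromℕ< a<G)))

    a≤combine : ∀ r → toℕ a ℕ.≤ toℕ (combine (fromℕ< a<G) r)
    a≤combine r = subst (toℕ a ℕ.≤_) (sym (Fin.toℕ-combine (fromℕ< a<G) r))
      (ℕ.≤-trans (ℕ.≤-reflexive (sym (Fin.toℕ-fromℕ< a<G)))
        (ℕ.≤-trans (ℕ.m≤n*m _ k) (ℕ.m≤m+n _ (toℕ r))))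

  childMachine-up : ∀ i → childMachine (parent i) (rank i) ≡ tree (suc i)
  childMachine-up i with toℕ (parent i) ℕ.<? #internal
  ... | no ≮ = contradiction (subst (ℕ._< #internal) (sym (Fin.toℕ-inject≤ _ #internal≤m)) (Fin.toℕ<n _)) ≮
  ... | yes < = cong (λ j → tree (suc j)) (trans (cong (λ q → combine q (rank i))
      (Fin.toℕ-injective (trans (Fin.toℕ-fromℕ< <) (Fin.toℕ-inject≤ _ #internal≤m))))
    (Fin.combine-remQuot {#internal} k i))

  -- The child of an internal node has a larger index, and at a leaf the other machine is an extra
  -- one.
  tree≢childMachine : ∀ a r → tree a ≢ childMachine a r
  tree≢childMachine a r eq with nodeView a
  ... | leaf _ aux-child = tree≢aux (trans eq (aux-child r))
  ... | internal children with children r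
  ...   | i , cm , _ , a<i = ℕ.<-irrefl (cong toℕ (tree-injective (trans eq cm))) a<i

  -- The second machine of `up (suc i)` is `tree (suc i)`, whereas a child job of that node has its
  -- second machine elsewhere.
  up≢child : ∀ a r → up a ≢ child a r
  up≢child (suc i) r eq = tree≢childMachine (suc i) r
    (sym (trans (cong₂ childMachine (sym (proj₁ same)) (sym (proj₂ same))) (childMachine-up i)))
    where
    same = child-injective {parent i} {suc i}
                           {rank i} {r} eq

  time-parent : ∀ a r → time (tree a) (child a r) ≡ [ 1 ]
  time-parent a r = trans (time-child (tree a) a r)
    (if-yes (tree a Fin.≟ tree a) refl)

  time-childMachine : ∀ a r → time (childMachine a r) (child a r) ≡ [ K ]
  time-childMachine a r = trans (time-child (childMachine a r) a r) (trans
    (if-no (childMachine a r Fin.≟ tree a) (tree≢childMachine a r ∘ sym))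
    (if-yes (childMachine a r Fin.≟ childMachine a r) refl))

  time-root : time (tree zero) zero ≡ [ k ]
  time-root = refl

  time-up : ∀ i → time (tree (suc i)) (up (suc i)) ≡ [ K ]
  time-up i = subst (λ i′ → time i′ (up (suc i)) ≡ [ K ]) (childMachine-up i)
    (time-childMachine (parent i) (rank i))

  finite-root : ∀ i → Finite (time i zero) → i ≡ tree zero
  finite-root i fin with i Fin.≟ tree zero
  ... | yes eq = eq

  finite-child : ∀ i a r → Finite (time i (child a r)) → i ≡ tree a ⊎ i ≡ childMachine a r
  finite-child i a r fin with subst Finite (time-child i a r) fin
  ... | fin′ with i Fin.≟ tree a | i Fin.≟ childMachine a r
  ...   | yes eq | _      = inj₁ eq
  ...   | no _   | yes eq = inj₂ eq

  I : Instance
  I = record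
    { #machines        = m ℕ.+ m
    ; #jobs            = suc (m ℕ.* k)
    ; machinesNonempty = _
    ; jobsNonempty     = _
    ; p                = time
    ; positive         = positive′
    ; schedulable      = schedulable′
    }
    where
    positive′ : ∀ i j → time i j ≢ [ 0 ]
    positive′ i zero eq with does (i Fin.≟ tree zero)
    positive′ i zero () | true
    positive′ i zero () | false
    positive′ i (suc j) eq with does (i Fin.≟ tree (quotient {m} k j))
    positive′ i (suc j) () | true
    ... | false with does (i Fin.≟ childMachine (quotient {m} k j) (remainder {m} k j))
    positive′ i (suc j) eq | false | true  = ℕ.≢-nonZero⁻¹ K ([]-injective eq)
    positive′ i (suc j) () | false | false

    schedulable′ : ∀ j → ∃[ i ] Finite (time i j)
    schedulable′ j with jobView j
    ... | root refl      = tree zero , subst Finite (sym time-root) finite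
    ... | below a r refl = tree a , subst Finite (sym (time-parent a r)) finite

  balancing : UnrelatedGraphBalancing I
  balancing j with jobView j
  ... | root refl      = ⊆pair⇒∣p∣≤2 (finiteMachines I zero) (tree zero) (tree zero) λ i i∈ →
    inj₁ (finite-root i (∈-tabulate⁻ (λ i → finite? (time i zero)) i∈))
  ... | below a r refl = ⊆pair⇒∣p∣≤2 (finiteMachines I (child a r)) (tree a) (childMachine a r) λ i i∈ →
    finite-child i a r (∈-tabulate⁻ (λ i → finite? (time i (child a r))) i∈)

  K≤time-up : ∀ a → [ K ] ≤⁺ time (tree a) (up a)
  K≤time-up zero    = [ ℕ.n≤1+n K ]
  K≤time-up (suc i) = ≤∞-reflexive (sym (time-up i))

  -- No schedule has makespan below 2K.

  module Overload (σ : Schedule I) {n : ℕ} (n<2K : n ℕ.< K ℕ.+ K) (bounded : makespan I σ ≤⁺ [ n ]) where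

    crowded : ∀ i {l} (e : Fin l → Job I) → (∀ {a b} → e a ≡ e b → a ≡ b) → (∀ a → σ (e a) ≡ i) →
              ¬ [ K ℕ.+ K ] ≤⁺ sum∞ (time i ∘ e)
    crowded i e inj on-i 2K≤ = ℕ.<⇒≱ n<2K
      ([≤]-injective (≤∞-trans 2K≤ (≤∞-trans (makespan-injective I σ i e inj on-i) bounded)))

    assigned-finite : ∀ j → Finite (time (σ j) j)
    assigned-finite j with time (σ j) j | ≤∞-trans
      (p≤cost I (σ j) (∈-tabulate⁺ (λ j′ → σ j′ Fin.≟ σ j) {j} refl))
      (≤∞-trans (max∞-lookup (λ i → cost I i (jobsOn I σ i)) (σ j)) bounded)
    ... | [ _ ] | _ = finite

    settled : ∀ a r → σ (child a r) ≡ tree a ⊎ σ (child a r) ≡ childMachine a r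
    settled a r = finite-child _ a r (assigned-finite (child a r))

    -- Two child jobs on the extra machine would already load it with 2K. The exceptional `r` is the
    -- job placed there, or an arbitrary one if there is none.
    all-but-one : ∀ a → (∀ r → childMachine a r ≡ aux a) →
                  ∃[ r ] ∀ s → σ (child a (punchIn r s)) ≡ tree a
    all-but-one a cm≡aux with Fin.any? (λ r → σ (child a r) Fin.≟ aux a)
    ... | no none = zero , λ s →
      [ (λ eq → eq) , (λ eq → contradiction (suc s , trans eq (cm≡aux (suc s))) none) ]′
      (settled a (suc s))
    ... | yes (r , on-aux) = r , λ s →
      [ (λ eq → eq)
      , (λ eq → contradiction (≤∞-reflexive (sym (heavy s)))
          (crowded (aux a) (two s) (two-injective s) (two-on-aux s (trans eq (cm≡aux _)))))
      ]′ (settled a (punchIn r s))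
      where
      two : Fin K → Fin 2 → Job I
      two s zero       = child a r
      two s (suc zero) = child a (punchIn r s)

      two-injective : ∀ s {b c} → two s b ≡ two s c → b ≡ c
      two-injective s {zero}     {zero}     eq = refl
      two-injective s {suc zero} {suc zero} eq = refl
      two-injective s {zero}     {suc zero} eq =
        contradiction (sym (proj₂ (child-injective {a} {a} eq))) (Fin.punchInᵢ≢i r s)
      two-injective s {suc zero} {zero}     eq =
        contradiction (proj₂ (child-injective {a} {a} eq)) (Fin.punchInᵢ≢i r s)

      two-on-aux : ∀ s → σ (child a (punchIn r s)) ≡ aux a → ∀ b → σ (two s b) ≡ aux a
      two-on-aux s eq zero       = on-aux
      two-on-aux s eq (suc zero) = eq

      big : ∀ r → time (aux a) (child a r) ≡ [ K ]
      big r = subst (λ i → time i (child a r) ≡ [ K ]) (cm≡aux r) (time-childMachine a r)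

      heavy : ∀ s → sum∞ (time (aux a) ∘ two s) ≡ [ K ℕ.+ K ]
      heavy s = trans (cong₂ (λ x y → x +∞ (y +∞ [ 0 ])) (big r) (big (punchIn r s)))
        (cong (λ l → [ K ℕ.+ l ]) (ℕ.+-identityʳ K))

    -- Induction towards the root, with `fuel` bounding the distance of `a` from the last index. At
    -- least `K` unit child jobs stay on `tree a`, and the up job, of time at least `K`, would raise
    -- the load to 2K.
    up-elsewhere : ∀ fuel a → m ℕ.≤ toℕ a ℕ.+ fuel → σ (up a) ≢ tree a
    up-elsewhere zero a m≤a _ =
      ℕ.<⇒≱ (Fin.toℕ<n a) (subst (m ℕ.≤_) (ℕ.+-identityʳ (toℕ a)) m≤a)
    up-elsewhere (suc fuel) a m≤ up-here = crowded (tree a) load load-injective load-on-tree heavy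
      where
      smalls : ∃[ r ] ∀ s → σ (child a (punchIn r s)) ≡ tree a
      smalls with nodeView a
      ... | leaf _ cm≡aux     = all-but-one a cm≡aux
      -- All `k` child jobs stay here; omitting number 0 leaves `K` of them, as at a leaf.
      ... | internal children = zero , λ s → kept (suc s)
        where
        kept : ∀ r → σ (child a r) ≡ tree a
        kept r = let i , cm , up-i , a<i = children r in
          [ (λ eq → eq)
          -- The child job is the up job of the child node, which by induction is not processed
          -- there.
          , (λ eq → contradiction (trans (cong σ up-i) (trans eq cm))
              (up-elsewhere fuel (suc i) (ℕ.≤-trans m≤ (ℕ.≤-trans
                (ℕ.≤-reflexive (ℕ.+-suc (toℕ a) fuel)) (ℕ.+-monoˡ-≤ fuel a<i)))))
          ]′ (settled a r)

      load : Fin k → Job I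
      load zero    = up a
      load (suc s) = child a (punchIn (proj₁ smalls) s)

      load-injective : ∀ {b c} → load b ≡ load c → b ≡ c
      load-injective {zero}  {zero}  eq = refl
      load-injective {zero}  {suc c} eq = contradiction eq (up≢child a _)
      load-injective {suc b} {zero}  eq = contradiction (sym eq) (up≢child a _)
      load-injective {suc b} {suc c} eq =
        cong suc (Fin.punchIn-injective (proj₁ smalls) b c (proj₂ (child-injective {a} {a} eq)))

      load-on-tree : ∀ b → σ (load b) ≡ tree a
      load-on-tree zero    = up-here
      load-on-tree (suc s) = proj₂ smalls s

      heavy : [ K ℕ.+ K ] ≤⁺ sum∞ (time (tree a) ∘ load)
      heavy = +∞-mono-≤ (K≤time-up a) (≤∞-reflexive (sym (trans
        (Sum∞.sum-cong-≗ {n = K} λ s → time-parent a (punchIn (proj₁ smalls) s))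
        (trans (sum∞-const K 1) (cong [_] (ℕ.*-identityʳ K))))))

    impossible : ⊥
    impossible = up-elsewhere m zero ℕ.≤-refl (finite-root _ (assigned-finite zero))

  2K≤makespan : ∀ σ → [ K ℕ.+ K ] ≤⁺ makespan I σ
  2K≤makespan σ with makespan I σ in eq
  ... | ∞     = _ ≤⊤⁺
  ... | [ n ] = [ ℕ.≮⇒≥ (λ n<2K → Overload.impossible σ n<2K (≤∞-reflexive eq)) ]

  -- A schedule of makespan 2K.

  -- Internal nodes pass all child jobs down and keep only their up job. A leaf gives one child job
  -- to its extra machine and keeps the other `K`, for a load of K + K including its up job.
  place : ∀ a → NodeView a → Fin k → Machine I
  place a (internal _) r       = childMachine a r
  place a (leaf _ _)   zero    = aux a
  place a (leaf _ _)   (suc _) = tree a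

  σ₀ : Schedule I
  σ₀ zero    = tree zero
  σ₀ (suc j) = place (quotient {m} k j) (nodeView _) (remainder {m} k j)

  σ₀-child : ∀ a r → σ₀ (child a r) ≡ place a (nodeView a) r
  σ₀-child a r = cong (λ ar → place (proj₁ ar) (nodeView (proj₁ ar)) (proj₂ ar))
    (Fin.remQuot-combine {m} {k} a r)

  σ₀-tree : ∀ b j → σ₀ j ≡ tree b →
            up b ≡ j ⊎ (childMachine b zero ≡ aux b × ∃[ s ] child b (suc s) ≡ j)
  σ₀-tree b j eq with jobView j
  ... | root refl      = inj₁ (cong up (sym (tree-injective eq)))
  ... | below a r refl with nodeView a | r | trans (sym (σ₀-child a r)) eq
  ...   | internal children | s     | cm≡b = let i , cm , up-i , _ = children s in
          inj₁ (trans (cong up (tree-injective (trans (sym cm≡b) cm))) up-i)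
  ...   | leaf _ _          | zero  | aux≡ = contradiction (sym aux≡) tree≢aux
  ...   | leaf _ cm≡aux     | suc s | a≡b with tree-injective a≡b
  ...     | refl = inj₂ (cm≡aux zero , s , refl)

  σ₀-aux : ∀ b j → σ₀ j ≡ aux b → childMachine b zero ≡ aux b × child b zero ≡ j
  σ₀-aux b j eq with jobView j
  ... | root refl      = contradiction eq tree≢aux
  ... | below a r refl with nodeView a | r | trans (sym (σ₀-child a r)) eq
  ...   | internal children | s     | cm≡b = let i , cm , _ = children s in
          contradiction (trans (sym cm) cm≡b) tree≢aux
  ...   | leaf _ _          | suc s | tree≡ = contradiction tree≡ tree≢aux
  ...   | leaf _ cm≡aux     | zero  | a≡b with aux-injective a≡b
  ...     | refl = cm≡aux zero , refl

  k≤2K : k ℕ.≤ K ℕ.+ K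
  k≤2K = ℕ.+-monoˡ-≤ K (ℕ.>-nonZero⁻¹ K)

  time-up≤2K : ∀ a → time (tree a) (up a) ≤⁺ [ K ℕ.+ K ]
  time-up≤2K zero    = [ k≤2K ]
  time-up≤2K (suc i) = ≤∞-trans (≤∞-reflexive (time-up i)) [ ℕ.m≤m+n K K ]

  -- Otherwise the root would be a leaf of depth 0, against `deep`. This matters because the up job
  -- of the root takes `k`, and as a leaf the root would have load k + K.
  0<#internal : 0 ℕ.< #internal
  0<#internal = ℕ.≰⇒> λ #internal≤0 →
    ℕ.<⇒≱ (ℕ.>-nonZero⁻¹ (K ℕ.* K) {{ℕ.m*n≢0 K K}}) (deep 0 #internal≤0)

  cost-σ₀ : ∀ i → cost I i (jobsOn I σ₀ i) ≤⁺ [ K ℕ.+ K ]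
  cost-σ₀ i with machineView i
  cost-σ₀ i | is-aux b refl with nodeView b
  ... | internal children = ≤∞-trans
    (cost-cover I (aux b) {l = 0} (λ ()) λ {j} j∈ →
      let i , cm , _ = children zero in contradiction
        (trans (sym cm) (proj₁ (σ₀-aux b j (∈-tabulate⁻ (λ j → σ₀ j Fin.≟ aux b) j∈)))) tree≢aux)
    0≤∞
  ... | leaf _ cm≡aux = ≤∞-trans
    (cost-cover I (aux b) {l = 1} (λ _ → child b zero) λ {j} j∈ →
      zero , proj₂ (σ₀-aux b j (∈-tabulate⁻ (λ j → σ₀ j Fin.≟ aux b) j∈)))
    (≤∞-trans (≤∞-reflexive (trans (+∞-identityʳ _)
        (subst (λ i → time i (child b zero) ≡ [ K ]) (cm≡aux zero) (time-childMachine b zero))))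
      [ ℕ.m≤m+n K K ])
  cost-σ₀ i | is-tree b refl with nodeView b
  ... | internal children = ≤∞-trans
    (cost-cover I (tree b) {l = 1} (λ _ → up b) λ {j} j∈ → zero ,
      [ (λ eq → eq) , (λ (cm≡aux , _) → let i , cm , _ = children zero in
          contradiction (trans (sym cm) cm≡aux) tree≢aux) ]′
        (σ₀-tree b j (∈-tabulate⁻ (λ j → σ₀ j Fin.≟ tree b) j∈)))
    (≤∞-trans (≤∞-reflexive (+∞-identityʳ _)) (time-up≤2K b))
  cost-σ₀ i | is-tree zero refl | leaf G≤0 _ = contradiction G≤0 (ℕ.<⇒≱ 0<#internal)
  cost-σ₀ i | is-tree b@(suc b′) refl | leaf _ _ = ≤∞-trans
    (cost-cover I (tree b) load λ {j} j∈ →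
      [ (λ eq → zero , eq) , (λ (_ , s , eq) → suc s , eq) ]′
        (σ₀-tree b j (∈-tabulate⁻ (λ j → σ₀ j Fin.≟ tree b) j∈)))
    (+∞-mono-≤ (≤∞-reflexive (time-up b′)) (≤∞-reflexive (trans
      (Sum∞.sum-cong-≗ {n = K} λ s → time-parent b (suc s))
      (trans (sum∞-const K 1) (cong [_] (ℕ.*-identityʳ K))))))
    where
    load : Fin k → Job I
    load zero    = up b
    load (suc s) = child b (suc s)

  minMakespan : IsMinMakespan I (K ℕ.+ K)
  minMakespan =
    (σ₀ , antisym (max∞-lub (λ i → cost I i (jobsOn I σ₀ i)) cost-σ₀) (2K≤makespan σ₀)) ,
    2K≤makespan
    where
    antisym : ∀ {x y} → x ≤⁺ y → y ≤⁺ x → x ≡ y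
    antisym = ≤⁺-antisym-≡ ℕ.≤-antisym

  -- A solution of the configuration-LP with target k.

  -- The fraction of each child job of node `n` that goes to the job's second machine. It is 1 at
  -- the root, whose machine is occupied by the root job.
  share : ℕ → ℚ
  share n = decay (depth n)

  -- The fraction of a job that is not processed by its parent node.
  W : Job I → ℚ
  W zero    = 1ℚ
  W (suc j) = share (toℕ (quotient {m} k j))

  0≤W : ∀ j → 0ℚ ≤ W j
  0≤W zero    = ℚ.nonNegative⁻¹ 1ℚ
  0≤W (suc j) = 0≤decay (depth (toℕ (quotient {m} k j)))

  W≤1 : ∀ j → W j ≤ 1ℚ
  W≤1 zero    = ℚ.≤-refl
  W≤1 (suc j) = decay≤1 (depth (toℕ (quotient {m} k j)))

  W-child : ∀ a r → W (child a r) ≡ share (toℕ a)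
  W-child a r = cong (λ ar → share (toℕ (proj₁ ar))) (Fin.remQuot-combine {m} {k} a r)

  toℕ-quotient : ∀ {n} (i : Fin (n ℕ.* k)) → toℕ i ℕ./ k ≡ toℕ (quotient {n} k i)
  toℕ-quotient {n} i = begin
    toℕ i ℕ./ k                             ≡⟨ cong (λ j → toℕ j ℕ./ k) (Fin.combine-remQuot {n} k i) ⟨
    toℕ (combine q r) ℕ./ k                 ≡⟨ cong (ℕ._/ k) (Fin.toℕ-combine q r) ⟩
    (k ℕ.* toℕ q ℕ.+ toℕ r) ℕ./ k           ≡⟨ ℕ.+-distrib-/-∣ˡ (toℕ r) (ℕ.m∣m*n (toℕ q)) ⟩
    k ℕ.* toℕ q ℕ./ k ℕ.+ toℕ r ℕ./ k       ≡⟨ cong (λ n → n ℕ./ k ℕ.+ toℕ r ℕ./ k) (ℕ.*-comm k (toℕ q)) ⟩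
    toℕ q ℕ.* k ℕ./ k ℕ.+ toℕ r ℕ./ k       ≡⟨ cong₂ ℕ._+_ (ℕ.m*n/n≡m (toℕ q) k) (ℕ.m<n⇒m/n≡0 (Fin.toℕ<n r)) ⟩
    toℕ q ℕ.+ 0                             ≡⟨ ℕ.+-identityʳ (toℕ q) ⟩
    toℕ q                                   ∎
    where
    open ≡-Reasoning
    q = quotient {n} k i
    r = remainder {n} k i

  -- One level down the tree costs one factor `α`; the division in `depth` agrees with the quotient
  -- in `parent`.
  share-suc : ∀ i → share (toℕ {m} (suc i)) ≡ α * W (up (suc i))
  share-suc i = begin
    decay (depth (suc (toℕ i)))                ≡⟨ cong decay (depth-suc (toℕ i)) ⟩
    α * share (toℕ i ℕ./ k)                    ≡⟨ cong (λ n → α * share n) (toℕ-quotient {#internal} i) ⟩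
    α * share (toℕ (quotient {#internal} k i))
      ≡⟨ cong (λ n → α * share n) (Fin.toℕ-inject≤ (quotient {#internal} k i) #internal≤m) ⟨
    α * share (toℕ (parent i))
      ≡⟨ cong (α *_) (W-child (parent i) (rank i)) ⟨
    α * W (up (suc i)) ∎
    where open ≡-Reasoning

  -- Entry 0 is idle time. At a leaf each child job is run alone with weight `share`, and
  -- `decay-small` keeps the idle weight nonnegative.
  auxWeight : ∀ a → NodeView a → Fin (suc k) → ℚ
  auxWeight a (internal _) zero    = 1ℚ
  auxWeight a (internal _) (suc _) = 0ℚ
  auxWeight a (leaf _ _)   zero    = 1ℚ - ⟦ k ⟧ * share (toℕ a)
  auxWeight a (leaf _ _)   (suc _) = share (toℕ a)

  -- Entry 0 of a tree machine is the configuration of all child jobs of its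
  -- node, and entry suc r pairs the up job with the r-th child job.
  weight : Node ⊎ Node → Fin (suc k) → ℚ
  weight (inj₁ zero)    zero    = 1ℚ
  weight (inj₁ zero)    (suc _) = 0ℚ
  weight (inj₁ (suc i)) zero    = 1ℚ - W (up (suc i))
  weight (inj₁ (suc i)) (suc _) = κ * W (up (suc i))
  weight (inj₂ a)       l       = auxWeight a (nodeView a) l

  pair : Node → Fin k → Fin 2 → Job I
  pair a r zero       = up a
  pair a r (suc zero) = child a r

  none : Fin 0 → Job I
  none ()

  auxConfig : ∀ a → NodeView a → Fin (suc k) → Subset (#jobs I)
  auxConfig a (leaf _ _)   (suc r) = image {1} λ _ → child a r
  auxConfig a (leaf _ _)   zero    = image none
  auxConfig a (internal _) _       = image none

  config : Node ⊎ Node → Fin (suc k) → Subset (#jobs I)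
  config (inj₁ zero)    _       = image {1} λ _ → zero
  config (inj₁ (suc i)) zero    = image (child (suc i))
  config (inj₁ (suc i)) (suc r) = image (pair (suc i) r)
  config (inj₂ a)       l       = auxConfig a (nodeView a) l

  -- At a non-root tree machine both kinds of configuration fill the target exactly: `k` unit jobs,
  -- or an up job of time `K` with one unit job.
  config-valid : ∀ s l → IsConfiguration I k (join m m s) (config s l)
  config-valid (inj₁ zero) l = ≤∞-trans
    (cost-cover I (tree zero) {l = 1} (λ _ → zero) (∈-image⁻ {1} λ _ → zero))
    [ ℕ.≤-reflexive (ℕ.+-identityʳ k) ]
  config-valid (inj₁ a@(suc i)) zero = ≤∞-trans
    (cost-cover I (tree a) (child a) (∈-image⁻ (child a)))
    (≤∞-reflexive (trans (Sum∞.sum-cong-≗ {n = k} (time-parent a))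
      (trans (sum∞-const k 1) (cong [_] (ℕ.*-identityʳ k)))))
  config-valid (inj₁ a@(suc i)) (suc r) = ≤∞-trans
    (cost-cover I (tree a) (pair a r) (∈-image⁻ (pair a r)))
    (≤∞-reflexive (trans (cong₂ (λ x y → x +∞ (y +∞ [ 0 ])) (time-up i) (time-parent a r))
      (cong [_] (ℕ.+-comm K 1))))
  config-valid (inj₂ a) l with nodeView a
  config-valid (inj₂ a) (suc r) | leaf _ cm≡aux = ≤∞-trans
    (cost-cover I (aux a) {l = 1} (λ _ → child a r) (∈-image⁻ {1} λ _ → child a r))
    (≤∞-trans (≤∞-reflexive (trans (+∞-identityʳ _)
        (subst (λ i → time i (child a r) ≡ [ K ]) (cm≡aux r) (time-childMachine a r))))
      [ ℕ.n≤1+n K ])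
  config-valid (inj₂ a) zero    | leaf _ _   = ≤∞-trans (cost-cover I (aux a) none (∈-image⁻ none)) 0≤∞
  config-valid (inj₂ a) l       | internal _ = ≤∞-trans (cost-cover I (aux a) none (∈-image⁻ none)) 0≤∞

  config-finite : ∀ s l {j} → j ∈ config s l → Finite (time (join m m s) j)
  config-finite s l {j} j∈ with time (join m m s) j | ≤∞-trans (p≤cost I (join m m s) j∈) (config-valid s l)
  ... | [ _ ] | _ = finite

  mass : ∀ s → sumℚ (weight s) ≡ 1ℚ
  mass (inj₁ zero) = trans (cong (_+_ 1ℚ) (Sumℚ.sum-replicate-zero k)) (ℚ.+-identityʳ 1ℚ)
  mass (inj₁ (suc i)) = begin
    (1ℚ - w) + sumℚ {k} (λ _ → κ * w)  ≡⟨ cong (_+_ (1ℚ - w)) (sumℚ-const k (κ * w)) ⟩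
    (1ℚ - w) + ⟦ k ⟧ * (κ * w)         ≡⟨ cong (_+_ (1ℚ - w)) (ℚ.*-assoc ⟦ k ⟧ κ w) ⟨
    (1ℚ - w) + ⟦ k ⟧ * κ * w           ≡⟨ cong (λ c → (1ℚ - w) + c * w) ⟦k⟧*κ≡1 ⟩
    (1ℚ - w) + 1ℚ * w                  ≡⟨ solve 1 (λ w → (con 1ℚ :- w) :+ con 1ℚ :* w := con 1ℚ) refl w ⟩
    1ℚ                                 ∎
    where
    open ≡-Reasoning
    open +-*-Solver using (solve; con; _:+_; _:-_; _:*_; _:=_)
    w = W (up (suc i))
  mass (inj₂ a) with nodeView a
  ... | internal _ = trans (cong (_+_ 1ℚ) (Sumℚ.sum-replicate-zero k)) (ℚ.+-identityʳ 1ℚ)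
  ... | leaf _ _   = trans (cong (_+_ (1ℚ - ⟦ k ⟧ * share (toℕ a))) (sumℚ-const k (share (toℕ a))))
    (solve 1 (λ w → (con 1ℚ :- w) :+ w := con 1ℚ) refl (⟦ k ⟧ * share (toℕ a)))
    where open +-*-Solver using (solve; con; _:+_; _:-_; _:=_)

  coverage : Node ⊎ Node → Job I → ℚ
  coverage s j = sumℚ λ l → if does (j ∈? config s l) then weight s l else 0ℚ

  coverage-infinite : ∀ s j → ¬ Finite (time (join m m s) j) → coverage s j ≡ 0ℚ
  coverage-infinite s j inf = Sumℚ.sum-zero _ λ l →
    if-no {x = weight s l} (j ∈? config s l) λ j∈ → inf (config-finite s l j∈)

  coverage-root : coverage (inj₁ zero) zero ≡ 1ℚ
  coverage-root = trans
    (Sumℚ.sum-cong-≗ λ l → if-yes {x = weight (inj₁ zero) l} {y = 0ℚ} (zero ∈? config (inj₁ zero) l)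
      (∈-image⁺ {1} (λ _ → zero) zero))
    (mass (inj₁ zero))

  -- At a non-root node with up weight `w`, the child job lies in entry 0 and in exactly one pair,
  -- so it receives (1 - w) + κ w = 1 - α w.
  coverage-parent : ∀ a r → coverage (inj₁ a) (child a r) ≡ 1ℚ - share (toℕ a)
  coverage-parent zero r = trans
    (Sumℚ.sum-zero _ λ l → if-no {x = weight (inj₁ zero) l} (child zero r ∈? config (inj₁ zero) l) λ j∈ →
      contradiction (proj₂ (∈-image⁻ {1} (λ _ → zero) j∈)) λ ())
    (sym (ℚ.+-inverseʳ 1ℚ))
  coverage-parent a@(suc i) r = begin
    coverage (inj₁ a) (child a r)
      ≡⟨ cong₂ _+_ (if-yes (child a r ∈? image (child a)) (∈-image⁺ (child a) r))
           (Sumℚ.sum-single pairs r λ r′ r′≢r →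
             if-no {x = κ * w} (child a r ∈? image (pair a r′)) (not-in r′ r′≢r)) ⟩
    (1ℚ - w) + pairs r
      ≡⟨ cong (_+_ (1ℚ - w)) (if-yes (child a r ∈? image (pair a r)) (∈-image⁺ (pair a r) (suc zero))) ⟩
    (1ℚ - w) + κ * w
      ≡⟨ solve 2 (λ w c → (con 1ℚ :- w) :+ c :* w := con 1ℚ :- (con 1ℚ :- c) :* w) refl w κ ⟩
    1ℚ - α * w
      ≡⟨ cong (1ℚ -_) (share-suc i) ⟨
    1ℚ - share (toℕ a) ∎
    where
    open ≡-Reasoning
    open +-*-Solver using (solve; con; _:+_; _:-_; _:*_; _:=_)
    w = W (up a)

    pairs : Fin k → ℚ
    pairs r′ = if does (child a r ∈? image (pair a r′)) then κ * w else 0ℚ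

    not-in : ∀ r′ → r′ ≢ r → child a r ∉ image (pair a r′)
    not-in r′ r′≢r j∈ with ∈-image⁻ (pair a r′) j∈
    ... | zero     , eq = up≢child a r eq
    ... | suc zero , eq = r′≢r (proj₂ (child-injective {a} {a} eq))

  -- The up job lies in all `k` pairs, each of weight κ w, and not in entry 0.
  coverage-up : ∀ i → coverage (inj₁ (suc i)) (up (suc i)) ≡ W (up (suc i))
  coverage-up i = begin
    coverage (inj₁ a) (up a)
      ≡⟨ cong₂ _+_
           (if-no {x = 1ℚ - w} (up a ∈? image (child a))
             (λ j∈ → let r , eq = ∈-image⁻ (child a) j∈ in up≢child a r (sym eq)))
           (Sumℚ.sum-cong-≗ λ r →
             if-yes {x = κ * w} {y = 0ℚ} (up a ∈? image (pair a r)) (∈-image⁺ (pair a r) zero)) ⟩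
    0ℚ + sumℚ {k} (λ _ → κ * w)  ≡⟨ ℚ.+-identityˡ _ ⟩
    sumℚ {k} (λ _ → κ * w)       ≡⟨ sumℚ-const k (κ * w) ⟩
    ⟦ k ⟧ * (κ * w)              ≡⟨ ℚ.*-assoc ⟦ k ⟧ κ w ⟨
    ⟦ k ⟧ * κ * w                ≡⟨ cong (_* w) ⟦k⟧*κ≡1 ⟩
    1ℚ * w                       ≡⟨ ℚ.*-identityˡ w ⟩
    w                            ∎
    where
    open ≡-Reasoning
    a : Node
    a = suc i
    w = W (up a)

  coverage-aux : ∀ a r → childMachine a r ≡ aux a → coverage (inj₂ a) (child a r) ≡ share (toℕ a)
  coverage-aux a r cm≡aux with nodeView a
  ... | internal children = let i , cm , _ = children r in
        contradiction (trans (sym cm) cm≡aux) tree≢aux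
  ... | leaf _ _ = trans
    (Sumℚ.sum-single entries (suc r) others)
    (if-yes (child a r ∈? image {1} (λ _ → child a r)) (∈-image⁺ {1} (λ _ → child a r) zero))
    where
    entries : Fin (suc k) → ℚ
    entries zero     = if does (child a r ∈? image none) then 1ℚ - ⟦ k ⟧ * share (toℕ a) else 0ℚ
    entries (suc r′) = if does (child a r ∈? image {1} λ _ → child a r′) then share (toℕ a) else 0ℚ

    others : ∀ l → l ≢ suc r → entries l ≡ 0ℚ
    others zero     _  = if-no (child a r ∈? image none) λ j∈ → contradiction (proj₁ (∈-image⁻ none j∈)) λ ()
    others (suc r′) r′≢r = if-no (child a r ∈? image {1} λ _ → child a r′) λ j∈ →
      r′≢r (cong suc (proj₂ (child-injective {a} {a} (proj₂ (∈-image⁻ {1} (λ _ → child a r′) j∈)))))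

  coverage-childMachine : ∀ a r → coverage (splitAt m (childMachine a r)) (child a r) ≡ share (toℕ a)
  coverage-childMachine a r with nodeView a
  ... | leaf _ cm≡aux = trans
    (cong (λ s → coverage s (child a r)) (trans (cong (splitAt m) (cm≡aux r)) (Fin.splitAt-↑ʳ m m a)))
    (coverage-aux a r (cm≡aux r))
  ... | internal children = let i , cm , up-i , _ = children r in trans
    (cong₂ coverage (trans (cong (splitAt m) cm) (Fin.splitAt-↑ˡ m (suc i) m)) (sym up-i))
    (trans (coverage-up i) (trans (cong W up-i) (W-child a r)))

  coverage-elsewhere : ∀ i j → ¬ Finite (time i j) → coverage (splitAt m i) j ≡ 0ℚ
  coverage-elsewhere i j inf = coverage-infinite (splitAt m i) j
    λ fin → inf (subst (λ i → Finite (time i j)) (Fin.join-splitAt m m i) fin)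

  covers : ∀ j → sumℚ (λ i → coverage (splitAt m i) j) ≡ 1ℚ
  covers j with jobView j
  ... | root refl = trans
    (Sumℚ.sum-single (λ i → coverage (splitAt m i) zero) (tree zero) λ i i≢ →
      coverage-elsewhere i zero λ fin → i≢ (finite-root i fin))
    coverage-root
  ... | below a r refl = begin
    sumℚ (λ i → coverage (splitAt m i) (child a r))
      ≡⟨ Sumℚ.sum-pair (λ i → coverage (splitAt m i) (child a r)) (tree≢childMachine a r) (λ i i≢tree i≢cm →
           coverage-elsewhere i (child a r) λ fin → [ i≢tree , i≢cm ]′ (finite-child i a r fin)) ⟩
    coverage (splitAt m (tree a)) (child a r) + coverage (splitAt m (childMachine a r)) (child a r)
      ≡⟨ cong₂ _+_ (trans (cong (λ s → coverage s (child a r)) (Fin.splitAt-↑ˡ m a m)) (coverage-parent a r))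
           (coverage-childMachine a r) ⟩
    (1ℚ - share (toℕ a)) + share (toℕ a)
      ≡⟨ solve 1 (λ w → (con 1ℚ :- w) :+ w := con 1ℚ) refl (share (toℕ a)) ⟩
    1ℚ ∎
    where
    open ≡-Reasoning
    open +-*-Solver using (solve; con; _:+_; _:-_; _:=_)

  weight-nonneg : ∀ s l → 0ℚ ≤ weight s l
  weight-nonneg (inj₁ zero)    zero    = ℚ.nonNegative⁻¹ 1ℚ
  weight-nonneg (inj₁ zero)    (suc _) = ℚ.≤-refl
  weight-nonneg (inj₁ (suc i)) zero    = 0≤1-p (W≤1 (up (suc i)))
  weight-nonneg (inj₁ (suc i)) (suc _) = ℚ.≤-trans (ℚ.≤-reflexive (sym (ℚ.*-zeroʳ κ)))
    (ℚ.*-monoˡ-≤-nonNeg κ {{ℚ.nonNegative 0≤κ}} (0≤W (up (suc i))))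
  weight-nonneg (inj₂ a) l with nodeView a
  weight-nonneg (inj₂ a) zero    | internal _ = ℚ.nonNegative⁻¹ 1ℚ
  weight-nonneg (inj₂ a) (suc _) | internal _ = ℚ.≤-refl
  weight-nonneg (inj₂ a) zero    | leaf G≤a _ = 0≤1-p (decay-small (depth (toℕ a)) (deep (toℕ a) G≤a))
  weight-nonneg (inj₂ a) (suc _) | leaf _ _   = 0≤decay (depth (toℕ a))

  configLP : ConfigLP I k
  configLP = mixture (weight ∘ splitAt m) (λ i → config (splitAt m i))
    (λ i → weight-nonneg (splitAt m i))
    (λ i l → subst (λ i′ → IsConfiguration I k i′ (config (splitAt m i) l)) (Fin.join-splitAt m m i)
      (config-valid (splitAt m i) l))
    (λ i → mass (splitAt m i)) covers

  configLPValue : IsConfigLPValue I k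
  configLPValue = configLP , λ T lp → k≤T T lp
    where
    fits : ∀ {T} i → time i zero ≤⁺ [ T ] → k ℕ.≤ T
    fits i time≤T with i Fin.≟ tree zero
    fits i [ k≤T ] | yes _ = k≤T

    k≤T : ∀ T → ConfigLP I T → k ℕ.≤ T
    -- Rounding any solution places the root job on a machine where it takes at most `T`; its only
    -- machine takes `k`.
    k≤T T lp = fits (Rounding.σ lp balancing zero) (Rounding.p-σ≤T lp balancing zero)

-- Comparing the ratios with 2.

open import Data.Integer.Base as ℤ using (+_; -[1+_])
open import Data.Rational.Base using (_/_)

p/q≤2 : ∀ c t .{{_ : ℕ.NonZero t}} → c ℕ.≤ 2 ℕ.* t → (+ c / t) ≤ (+ 2 / 1)
p/q≤2 c (suc t) c≤2t = ℚ.toℚᵘ-cancel-≤ (begin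
  ℚ.toℚᵘ (+ c / suc t)   ≃⟨ ℚ.toℚᵘ-fromℚᵘ (mkℚᵘ (+ c) t) ⟩
  mkℚᵘ (+ c) t           ≤⟨ ℚᵘ.*≤* (subst₂ ℤ._≤_
                             (sym (ℤ.*-identityʳ (+ c))) (ℤ.pos-* 2 (suc t)) (ℤ.+≤+ c≤2t)) ⟩
  ℚ.toℚᵘ (+ 2 / 1)       ∎)
  where open ℚᵘ.≤-Reasoning

-- For q = n/d ≥ 0 and K = 2d, q < 2 means n + 1 ≤ K. Hence n (K + 1) < (n + 1) K ≤ K² = 2K d. A
-- negative `q` is below the positive ratio anyway.
2-2/k-dense : ∀ q → q < (+ 2 / 1) → let K = 2 ℕ.* ℚ.↧ₙ q in q < (+ (K ℕ.+ K) / suc K)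
2-2/k-dense (ℚ.mkℚ -[1+ n ] d-1 c) _ =
  ℚ.neg<pos (ℚ.mkℚ -[1+ n ] d-1 c) (+ (K ℕ.+ K) / suc K)
    {{_}} {{ℚ.normalize-pos (K ℕ.+ K) (suc K)}}
  where
  K = 2 ℕ.* suc d-1
2-2/k-dense q@(ℚ.mkℚ (+ n) d-1 _) (ℚ.*<* n<2d) = ℚ.toℚᵘ-cancel-< (begin-strict
  ℚ.toℚᵘ q                      <⟨ ℚᵘ.*<* (subst₂ ℤ._<_ (ℤ.pos-* n (suc K))
                                     (ℤ.pos-* (K ℕ.+ K) d) (ℤ.+<+ bound)) ⟩
  mkℚᵘ (+ (K ℕ.+ K)) K          ≃⟨ ℚ.toℚᵘ-fromℚᵘ (mkℚᵘ (+ (K ℕ.+ K)) K) ⟨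
  ℚ.toℚᵘ (+ (K ℕ.+ K) / suc K)  ∎)
  where
  open ℚᵘ.≤-Reasoning
  d = suc d-1
  K = 2 ℕ.* d

  n<K : n ℕ.< K
  n<K = ℤ.drop‿+<+ (subst₂ ℤ._<_ (ℤ.*-identityʳ (+ n)) (sym (ℤ.pos-* 2 d)) n<2d)

  bound : n ℕ.* suc K ℕ.< (K ℕ.+ K) ℕ.* d
  bound = ℕ.<-≤-trans
    (subst (ℕ._< suc n ℕ.* K) (sym (ℕ.*-suc n K)) (ℕ.+-monoˡ-< (n ℕ.* K) n<K))
    (ℕ.≤-trans (ℕ.*-monoˡ-≤ K n<K) (ℕ.≤-reflexive (K*K≡2K*d)))
    where
    K*K≡2K*d : K ℕ.* K ≡ (K ℕ.+ K) ℕ.* d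
    K*K≡2K*d = trans (sym (ℕ.*-assoc K 2 d))
      (cong (ℕ._* d) (trans (ℕ.*-comm K 2) (cong (K ℕ.+_) (ℕ.+-identityʳ K))))

theorem2 : IsIntegralityGap UnrelatedGraphBalancing (+ 2 / 1)
theorem2 = upper , lower
  where
  upper : ∀ r → GapRatio UnrelatedGraphBalancing r → r ≤ (+ 2 / 1)
  upper _ (ratio I {c} {t} ugb isMin v) =
    p/q≤2 c t {{configLPValue-nonZero v}} (minMakespan≤2T ugb isMin (proj₁ v))

  lower : ∀ q → q < (+ 2 / 1) → ∃[ r ] (GapRatio UnrelatedGraphBalancing r × q < r)
  lower q q<2 = (+ (K ℕ.+ K) / suc K) ,
    ratio I balancing minMakespan configLPValue , 2-2/k-dense q q<2
    where
    K = 2 ℕ.* ℚ.↧ₙ q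

    open Heap (suc K)
    -- Taking all nodes of depth below K² as internal puts every leaf at depth at least K².
    open Gap K (size (K ℕ.* K)) (depth-≥ (K ℕ.* K))
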